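{- If $D$ is a generalized skew diagram, then $\mathrm{MaxG}(D)=\mathrm{sf}(D)$.
   Context: A diagram is a finite set of cells at positions $(r,c)$ with $r,c$ positive integers ($r$ = row from the bottom, $c$ = column), at most one cell per position; each cell is either ordinary, written $(r,c)$, or a ghost cell, written $\langle r,c\rangle$. A position is empty if it contains no cell. K-Kohnert move at row $r$ of $D$: let the rightmost cell of row $r$ (ghost or not) lie in column $c$. The move does nothing if that cell is a ghost cell, or every position $(r',c)$ with $r'<r$ is occupied, or, letting $\hat r<r$ be maximal with $(\hat r,c)$ empty, some $(r^*,c)$ with $\hat r<r^*<r$ holds a ghost cell. Otherwise there are two choices: the Kohnert move moves the cell from $(r,c)$ to $(\hat r,c)$; the ghost move does the same and additionally places a ghost cell $\langle r,c\rangle$ at $(r,c)$. $KKD(D)$ is the set of $D$ and all diagrams obtained from $D$ by finite sequences of K-Kohnert moves; $\mathrm{MaxG}(D)$ is the maximum number of ghost cells in a diagram of $KKD(D)$. Snow diagram: for $D$ with no ghost cells, process rows from top to bottom; in each row mark the rightmost cell of that row with no already-marked cell above it in its column (if any); marked cells are dark clouds. Place a snowflake in each empty position strictly below a dark cloud in the same column; $\mathrm{sf}(D)$ is the number of snowflakes. Generalized skew diagram: a diagram $D$ with no ghost cells whose nonempty rows are $r_1<\dots<r_n$, such that, writing $c_i^+$ (resp. $c_i^-$) for the column of the rightmost (resp. leftmost) cell of row $r_i$: for each $i$, $(r_i,\tilde c)\in D$ for all $c_i^-<\tilde c<c_i^+$; and $c_i^+\le c_j^+$, $c_i^-\le c_j^-$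 whenever $i<j$. -}

module Defs where

open import Data.Nat using (ℕ; zero; suc; _+_; _≤_; _<_; _≡ᵇ_; _<ᵇ_; _⊔_)
open import Data.Bool using (Bool; true; false; _∧_; not; if_then_else_)
open import Data.List using (List; []; _∷_; _++_; map; filterᵇ; length; foldr)
open import Data.Bool.ListAction using (any)
open import Data.Nat.ListAction using (sum)
open import Data.List.Membership.Propositional using (_∈_; _∉_)
open import Data.List.Relation.Unary.All using (All)
open import Data.List.Relation.Unary.Unique.Propositional using (Unique)
open import Data.List.Relation.Binary.Permutation.Propositional using (_↭_)
open import Data.Maybe using (Maybe; just; nothing)
open import Data.Product using (_×_; _,_; proj₁; proj₂; ∃; ∃-syntax)
open import Relation.Binary.PropositionalEquality using (_≡_)
open import Relation.Binary.Construct.Closure.ReflexiveTransitive using (Star)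

data Kind : Set where
  ordinary ghost : Kind

-- a cell: (row r (from the bottom), column c, kind)
Cell : Set
Cell = ℕ × ℕ × Kind

row : Cell → ℕ
row (r , _ , _) = r

col : Cell → ℕ
col (_ , c , _) = c

pos : Cell → ℕ × ℕ
pos (r , c , _) = (r , c)

Diagram : Set
Diagram = List Cell

WellFormed : Diagram → Set
WellFormed D = All (λ x → 1 ≤ row x × 1 ≤ col x) D × Unique (map pos D)

NoGhost : Diagram → Set
NoGhost D = ∀ r c → (r , c , ghost) ∉ D

isGhost : Cell → Bool
isGhost (_ , _ , ghost) = true
isGhost (_ , _ , ordinary) = false

ghosts : Diagram → ℕ
ghosts D = length (filterᵇ isGhost D)

-- Step D D' : D' is obtained from D by a (nontrivial) K-Kohnert move at
-- some row r.  The rightmost cell of row r is the ordinary cell (r,c);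
-- r̂ (here rh) is maximal below r with (rh,c) empty, i.e. 1 ≤ rh < r,
-- (rh,c) empty and every (r',c) with rh < r' < r occupied; and none of
-- those cells is a ghost cell, i.e. they are all ordinary cells.
data Step (D : Diagram) : Diagram → Set where
  kohnert : ∀ {r c rh rest} →
    D ↭ ((r , c , ordinary) ∷ rest) →
    (∀ {c' k} → (r , c' , k) ∈ D → c' ≤ c) →
    1 ≤ rh → rh < r →
    (∀ k → (rh , c , k) ∉ D) →
    (∀ r' → rh < r' → r' < r → (r' , c , ordinary) ∈ D) →
    Step D ((rh , c , ordinary) ∷ rest)
  ghostMove : ∀ {r c rh rest} →
    D ↭ ((r , c , ordinary) ∷ rest) →
    (∀ {c' k} → (r , c' , k) ∈ D → c' ≤ c) →
    1 ≤ rh → rh < r →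
    (∀ k → (rh , c , k) ∉ D) →
    (∀ r' → rh < r' → r' < r → (r' , c , ordinary) ∈ D) →
    Step D ((rh , c , ordinary) ∷ (r , c , ghost) ∷ rest)

InKKD : Diagram → Diagram → Set
InKKD D D' = Star Step D D'

IsMaxG : Diagram → ℕ → Set
IsMaxG D m = (∃[ D' ] (InKKD D D' × ghosts D' ≡ m))
           × (∀ D' → InKKD D D' → ghosts D' ≤ m)

-- Snow diagram (for diagrams without ghost cells; kinds are ignored)

occupied : Diagram → ℕ → ℕ → Bool
occupied D r c = any (λ x → (row x ≡ᵇ r) ∧ (col x ≡ᵇ c)) D

elemᵇ : ℕ → List ℕ → Bool
elemᵇ c = any (λ c' → c' ≡ᵇ c)

maxRow : Diagram → ℕ
maxRow D = foldr (λ x m → row x ⊔ m) 0 D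

maxMaybe : List ℕ → Maybe ℕ
maxMaybe [] = nothing
maxMaybe (x ∷ xs) with maxMaybe xs
... | nothing = just x
... | just y  = just (x ⊔ y)

candidates : Diagram → ℕ → List ℕ → List ℕ
candidates D r marked =
  map col (filterᵇ (λ x → (row x ≡ᵇ r) ∧ not (elemᵇ (col x) marked)) D)

-- process rows n, n-1, ..., 1 (top to bottom), given the columns already
-- holding a marked cell (all of which lie above the current row);
-- returns the dark clouds (row, column)
cloudsFrom : Diagram → ℕ → List ℕ → List (ℕ × ℕ)
cloudsFrom D zero marked = []
cloudsFrom D (suc r) marked with maxMaybe (candidates D (suc r) marked)
... | nothing = cloudsFrom D r marked
... | just c  = (suc r , c) ∷ cloudsFrom D r (c ∷ marked)

darkClouds : Diagram → List (ℕ × ℕ)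
darkClouds D = cloudsFrom D (maxRow D) []

rowsUpTo : ℕ → List ℕ
rowsUpTo zero = []
rowsUpTo (suc n) = rowsUpTo n ++ (suc n ∷ [])

snowBelow : Diagram → ℕ × ℕ → ℕ
snowBelow D (r , c) = length (filterᵇ (λ r' → not (occupied D r' c)) (rowsUpTo (r Data.Nat.∸ 1)))

sf : Diagram → ℕ
sf D = sum (map (snowBelow D) (darkClouds D))

IsRightmost : Diagram → ℕ → ℕ → Set
IsRightmost D r c = (∃[ k ] (r , c , k) ∈ D) × (∀ {c' k} → (r , c' , k) ∈ D → c' ≤ c)

IsLeftmost : Diagram → ℕ → ℕ → Set
IsLeftmost D r c = (∃[ k ] (r , c , k) ∈ D) × (∀ {c' k} → (r , c' , k) ∈ D → c ≤ c')

record GeneralizedSkew (D : Diagram) : Set where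
  field
    noGhost : NoGhost D
    rowInterval : ∀ {r c⁻ c⁺} → IsLeftmost D r c⁻ → IsRightmost D r c⁺ →
                  ∀ c → c⁻ < c → c < c⁺ → (r , c , ordinary) ∈ D
    rightMono : ∀ {ri rj ci cj} → ri < rj →
                IsRightmost D ri ci → IsRightmost D rj cj → ci ≤ cj
    leftMono : ∀ {ri rj ci cj} → ri < rj →
               IsLeftmost D ri ci → IsLeftmost D rj cj → ci ≤ cj

{-# OPTIONS --safe #-}
module Submission where

-- Let N E c x be the number of ordinary cells of E in column c and rows 1..x.
--
-- Upper bound.  The snow diagram is a greedy maximum weight matching of rows with
-- columns, the weight i − N D c i of a cell (i,c) being the number of empty
-- positions below it; as D is skew, greedy is optimal, and linear programming
-- duality yields u, v with i − N D c i ≤ u i + v c on D and ∑ u + ∑ v ≤ sf D.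
-- In a diagram E reached from D, a ghost (g,c) gets as label the row i of D from
-- which the cell that left it there came.  Ghosts of one label lie in different
-- rows g, because of two cells of one row of D the right one always stays weakly
-- below the left one.  Hence at most u i ghosts of label i have i − g < u i, and a
-- ghost with i − g ≥ u i is among the lowest v c non-ordinary positions of its column.
--
-- Lower bound.  Treat the rows of D from bottom to top.  In each row push the cells to the
-- right of the dark cloud down as far as possible by Kohnert moves, and then push
-- down the dark cloud by ghost moves: it passes exactly the snowflakes below it.

open import Defs
open import Data.Bool using (Bool; true; false; T; if_then_else_; _∧_; not)
open import Data.Bool.Properties using (T-∧; T?)
open import Data.Empty using (⊥; ⊥-elim)
open import Data.List using (List; []; _∷_; _++_; map; filter; filterᵇ; length; upTo)
open import Data.List.Extrema.Nat using (max; xs≤max)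
open import Data.List.Membership.Propositional using (_∈_; _∉_; find)
open import Data.List.Membership.Propositional.Properties
  using (∈-map⁺; ∈-map⁻; ∈-filter⁺; ∈-filter⁻; ∈-∃++; ∈-++⁺ˡ; ∈-++⁺ʳ; ∈-upTo⁺)
open import Data.List.Properties using (length-++; length-map; length-upTo; filter-++; filter-none)
open import Data.List.Relation.Binary.Permutation.Propositional using (_↭_; ↭-sym; ↭⇒↭ₛ)
import Data.List.Relation.Binary.Permutation.Propositional.Properties as Perm
import Data.List.Relation.Binary.Permutation.Setoid.Properties as SetoidPerm
open import Data.List.Relation.Unary.All as All using (All; []; _∷_)
import Data.List.Relation.Unary.AllPairs as AllPairs
open import Data.List.Relation.Unary.AllPairs using ([]; _∷_)
open import Data.List.Relation.Unary.Any as Any using (here; there)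
open import Data.List.Relation.Unary.Any.Properties using (any⁺; any⁻)
open import Data.List.Relation.Unary.Unique.Propositional using (Unique)
import Data.List.Relation.Unary.Unique.Propositional.Properties as Uniqueₚ
open import Data.Maybe using (just; nothing)
open import Data.Nat using (ℕ; zero; suc; _+_; _∸_; _≤_; _<_; _⊔_; _≡ᵇ_; _≤?_; _<?_; _≟_; z≤n; s≤s)
open import Data.Nat.ListAction using (sum)
open import Data.Nat.Properties hiding (_≟_; _≤?_; _<?_)
open import Algebra.Properties.CommutativeSemigroup +-commutativeSemigroup using (interchange; x∙yz≈y∙xz)
open import Data.Nat.Solver using (module +-*-Solver)
open import Data.Product using (_×_; _,_; proj₁; proj₂; ∃-syntax)
open import Data.Product.Properties using (≡-dec)
open import Data.Sum using (_⊎_; inj₁; inj₂; [_,_]′)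
open import Function using (_∘_; Equivalence)
open import Relation.Binary using (DecidableEquality; tri<; tri≈; tri>)
open import Relation.Binary.Construct.Closure.ReflexiveTransitive using (ε; _◅_; _◅◅_)
open import Relation.Binary.PropositionalEquality
  using (_≡_; _≢_; refl; sym; trans; cong; cong₂; subst; setoid; module ≡-Reasoning)
open import Relation.Nullary using (¬_; ¬?; yes; no; does)

-- Cells and well-formed diagrams

_≟ᴷ_ : DecidableEquality Kind
ordinary ≟ᴷ ordinary = yes refl
ordinary ≟ᴷ ghost = no λ ()
ghost ≟ᴷ ordinary = no λ ()
ghost ≟ᴷ ghost = yes refl

_≟ᶜ_ : DecidableEquality Cell
_≟ᶜ_ = ≡-dec _≟_ (≡-dec _≟_ _≟ᴷ_)

open import Data.List.Membership.DecPropositional _≟ᶜ_ using (_∈?_)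
open import Data.List.Membership.DecPropositional _≟_ using () renaming (_∈?_ to _∈ℕ?_)

Ord : Diagram → ℕ → ℕ → Set
Ord E r c = (r , c , ordinary) ∈ E

Ghost : Diagram → ℕ → ℕ → Set
Ghost E r c = (r , c , ghost) ∈ E

row≥1 : ∀ {E r c k} → WellFormed E → (r , c , k) ∈ E → 1 ≤ r
row≥1 (ge , _) m = proj₁ (All.lookup ge m)

col≥1 : ∀ {E r c k} → WellFormed E → (r , c , k) ∈ E → 1 ≤ c
col≥1 (ge , _) m = proj₂ (All.lookup ge m)

Unique-map⇒injective : ∀ {A B : Set} {f : A → B} {xs : List A} → Unique (map f xs) →
                       ∀ {x y} → x ∈ xs → y ∈ xs → f x ≡ f y → x ≡ y
Unique-map⇒injective u (here refl) (here refl) e = refl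
Unique-map⇒injective {f = f} (h ∷ u) (here refl) (there q) e = ⊥-elim (All.lookup h (∈-map⁺ f q) e)
Unique-map⇒injective {f = f} (h ∷ u) (there p) (here refl) e = ⊥-elim (All.lookup h (∈-map⁺ f p) (sym e))
Unique-map⇒injective (h ∷ u) (there p) (there q) e = Unique-map⇒injective u p q e

ord∧ghost⇒⊥ : ∀ {E r c} → WellFormed E → Ord E r c → Ghost E r c → ⊥
ord∧ghost⇒⊥ (_ , u) p q with () ← Unique-map⇒injective u p q refl

Unique-resp-↭ : ∀ {A : Set} {xs ys : List A} → xs ↭ ys → Unique xs → Unique ys
Unique-resp-↭ {A} p = SetoidPerm.Unique-resp-↭ (setoid A) (↭⇒↭ₛ p)

WellFormed-resp-↭ : ∀ {E E'} → E ↭ E' → WellFormed E → WellFormed E'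
WellFormed-resp-↭ p (ge , u) = Perm.All-resp-↭ p ge , Unique-resp-↭ (Perm.map⁺ pos p) u

-- Counting the ordinary cells of a column

χ : Diagram → ℕ → ℕ → ℕ
χ E r c = if does ((r , c , ordinary) ∈? E) then 1 else 0

χ-in : ∀ {E r c} → Ord E r c → χ E r c ≡ 1
χ-in {E} {r} {c} m with (r , c , ordinary) ∈? E
... | yes _ = refl
... | no ¬m = ⊥-elim (¬m m)

χ-out : ∀ {E r c} → ¬ Ord E r c → χ E r c ≡ 0
χ-out {E} {r} {c} ¬m with (r , c , ordinary) ∈? E
... | yes m = ⊥-elim (¬m m)
... | no _ = refl

χ≤1 : ∀ E r c → χ E r c ≤ 1
χ≤1 E r c with (r , c , ordinary) ∈? E
... | yes _ = s≤s z≤n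
... | no _ = z≤n

χ-cong : ∀ {E E' r c r' c'} → (Ord E r c → Ord E' r' c') → (Ord E' r' c' → Ord E r c) →
         χ E r c ≡ χ E' r' c'
χ-cong {E} {E'} {r} {c} f g with (r , c , ordinary) ∈? E
... | yes m = sym (χ-in (f m))
... | no ¬m = sym (χ-out (¬m ∘ g))

N : Diagram → ℕ → ℕ → ℕ
N E c zero = 0
N E c (suc x) = χ E (suc x) c + N E c x

N-suc-in : ∀ {E c x} → Ord E (suc x) c → N E c (suc x) ≡ suc (N E c x)
N-suc-in {E} {c} {x} m = cong (_+ N E c x) (χ-in m)

N-suc-out : ∀ {E c x} → ¬ Ord E (suc x) c → N E c (suc x) ≡ N E c x
N-suc-out {E} {c} {x} m = cong (_+ N E c x) (χ-out m)

N-mono : ∀ E c {x y} → x ≤ y → N E c x ≤ N E c y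
N-mono E c {y = zero} z≤n = ≤-refl
N-mono E c {x} {suc y} x≤y with m≤n⇒m<n∨m≡n x≤y
... | inj₁ (s≤s x≤y') = ≤-trans (N-mono E c x≤y') (m≤n+m _ _)
... | inj₂ refl = ≤-refl

-- The number `x ∸ N E c x` of non-ordinary positions in rows 1..x cannot decrease with `x`. Both
-- sides are sums in order to avoid truncated subtraction.
N-lipschitz : ∀ E c {x y} → x ≤ y → x + N E c y ≤ y + N E c x
N-lipschitz E c {y = zero} z≤n = ≤-refl
N-lipschitz E c {x} {suc y} x≤y with m≤n⇒m<n∨m≡n x≤y
... | inj₂ refl = ≤-refl
... | inj₁ (s≤s x≤y') = begin
  x + (χ E (suc y) c + N E c y)  ≤⟨ +-monoʳ-≤ x (+-monoˡ-≤ _ (χ≤1 E (suc y) c)) ⟩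
  x + suc (N E c y)              ≡⟨ +-suc x _ ⟩
  suc (x + N E c y)              ≤⟨ s≤s (N-lipschitz E c x≤y') ⟩
  suc (y + N E c x)              ∎
  where open ≤-Reasoning

N≤ : ∀ E c x → N E c x ≤ x
N≤ E c x = ≤-trans (N-lipschitz E c z≤n) (≤-reflexive (+-identityʳ x))

-- Equality case of `N-lipschitz`: a run of ordinary cells adds no non-ordinary position.
N-full : ∀ E c {x y} → x ≤ y → (∀ z → x < z → z ≤ y → Ord E z c) → x + N E c y ≡ y + N E c x
N-full E c {y = zero} z≤n f = refl
N-full E c {x} {suc y} x≤y f with m≤n⇒m<n∨m≡n x≤y
... | inj₂ refl = refl
... | inj₁ (s≤s x≤y') = begin
  x + N E c (suc y)  ≡⟨ cong (x +_) (N-suc-in (f (suc y) (s≤s x≤y') ≤-refl)) ⟩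
  x + suc (N E c y)  ≡⟨ +-suc x _ ⟩
  suc (x + N E c y)  ≡⟨ cong suc (N-full E c x≤y' (λ z p q → f z p (m≤n⇒m≤1+n q))) ⟩
  suc (y + N E c x)  ∎
  where open ≡-Reasoning

-- Only the rows above `x` enter the two increments, so agreement there suffices, whatever the
-- columns look like below.
N-cong : ∀ {E E' c c'} x y → x ≤ y → (∀ z → x < z → z ≤ y → χ E z c ≡ χ E' z c') →
         N E c y + N E' c' x ≡ N E' c' y + N E c x
N-cong {E} {E'} {c} {c'} x zero z≤n f = refl
N-cong {E} {E'} {c} {c'} x (suc y) x≤y f with m≤n⇒m<n∨m≡n x≤y
... | inj₂ refl = +-comm (N E c x) _
... | inj₁ (s≤s x≤y') = begin
  χ E (suc y) c + N E c y + N E' c' x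
    ≡⟨ +-assoc (χ E (suc y) c) _ _ ⟩
  χ E (suc y) c + (N E c y + N E' c' x)
    ≡⟨ cong₂ _+_ (f (suc y) (s≤s x≤y') ≤-refl) (N-cong x y x≤y' (λ z p q → f z p (m≤n⇒m≤1+n q))) ⟩
  χ E' (suc y) c' + (N E' c' y + N E c x)
    ≡⟨ sym (+-assoc (χ E' (suc y) c') _ _) ⟩
  χ E' (suc y) c' + N E' c' y + N E c x
    ∎
  where open ≡-Reasoning

N-pos : ∀ {E c x} → 1 ≤ x → Ord E x c → 1 ≤ N E c x
N-pos {E} {c} {suc x} _ m = subst (1 ≤_) (sym (N-suc-in m)) (s≤s z≤n)

N-pos⁻ : ∀ {E c} x → 1 ≤ N E c x → ∃[ j ] (j ≤ x × Ord E j c)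
N-pos⁻ {E} {c} (suc x) p with (suc x , c , ordinary) ∈? E
... | yes m = suc x , ≤-refl , m
... | no _ with j , j≤x , m ← N-pos⁻ x p = j , m≤n⇒m≤1+n j≤x , m

-- `N` rises by steps of one, so each value is first reached at an ordinary cell. This recovers the
-- row of `D` from which a cell or a ghost of `E` stems.
nth-cell : ∀ E c x m → 1 ≤ m → m ≤ N E c x →
           ∃[ i ] (1 ≤ i × i ≤ x × Ord E i c × N E c i ≡ m)
nth-cell E c zero zero () m≤
nth-cell E c zero (suc m) 1≤m ()
nth-cell E c (suc x) m 1≤m m≤ with m ≤? N E c x
... | yes p with i , a , b , o , e ← nth-cell E c x m 1≤m p = i , a , m≤n⇒m≤1+n b , o , e
... | no ¬p with (suc x , c , ordinary) ∈? E in eq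
...   | no _ = ⊥-elim (¬p m≤)
...   | yes o = suc x , s≤s z≤n , ≤-refl , o ,
        trans (N-suc-in o) (≤-antisym (≰⇒> ¬p) m≤)

N-cell-inj : ∀ {E c x y} → 1 ≤ y → Ord E y c → N E c y ≤ N E c x → y ≤ x
N-cell-inj {E} {c} {x} {suc y} _ o le with suc y ≤? x
... | yes p = p
... | no ¬p = ⊥-elim (<-irrefl refl (≤-trans (subst (_≤ N E c x) (N-suc-in o) le)
                (N-mono E c (≤-pred (≰⇒> ¬p)))))

N-in : ∀ {E c} x → 1 ≤ x → Ord E x c → N E c x ≡ suc (N E c (x ∸ 1))
N-in (suc x) _ = N-suc-in

N-out : ∀ {E c} x → ¬ Ord E x c → N E c x ≡ N E c (x ∸ 1)
N-out zero _ = refl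
N-out {E} (suc x) = N-suc-out {E}

N-below-cell : ∀ {E c x y} → x < y → Ord E y c → N E c x < N E c y
N-below-cell {E} {c} {x} {suc y} (s≤s x≤y) o = subst (N E c x <_) (sym (N-suc-in o)) (s≤s (N-mono E c x≤y))

suc[x∸1] : ∀ {x} → 1 ≤ x → suc (x ∸ 1) ≡ x
suc[x∸1] {suc x} _ = refl

-- Boolean tests and maxima in the snow diagram

T-not⁺ : ∀ {b} → ¬ T b → T (not b)
T-not⁺ {false} _ = _
T-not⁺ {true} ¬t = ⊥-elim (¬t _)

T-not⁻ : ∀ {b} → T (not b) → ¬ T b
T-not⁻ {false} _ ()

elemᵇ⁺ : ∀ {c M} → c ∈ M → T (elemᵇ c M)
elemᵇ⁺ {c} m = any⁺ _ (Any.map (λ { refl → ≡⇒≡ᵇ c c refl }) m)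

elemᵇ⁻ : ∀ {c} M → T (elemᵇ c M) → c ∈ M
elemᵇ⁻ {c} M t = Any.map (λ {x} e → sym (≡ᵇ⇒≡ x c e)) (any⁻ _ M t)

∈-candidates⁺ : ∀ D r M {c k} → (r , c , k) ∈ D → c ∉ M → c ∈ candidates D r M
∈-candidates⁺ D r M {c} m c∉M =
  ∈-map⁺ col (∈-filter⁺ (T? ∘ _) m
    (Equivalence.from T-∧ (≡⇒≡ᵇ r r refl , T-not⁺ (c∉M ∘ elemᵇ⁻ M))))

∈-candidates⁻ : ∀ D r M {c} → c ∈ candidates D r M → (∃[ k ] (r , c , k) ∈ D) × c ∉ M
∈-candidates⁻ D r M m
  with (r' , c , k) , x∈ , refl ← ∈-map⁻ col m
  with x∈D , t ← ∈-filter⁻ (T? ∘ _) x∈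
  with e , t' ← Equivalence.to T-∧ t
  with refl ← ≡ᵇ⇒≡ r' r e
  = (k , x∈D) , T-not⁻ t' ∘ elemᵇ⁺

maxMaybe-nothing : ∀ xs → maxMaybe xs ≡ nothing → xs ≡ []
maxMaybe-nothing [] e = refl
maxMaybe-nothing (x ∷ xs) e with maxMaybe xs
maxMaybe-nothing (x ∷ xs) () | nothing
maxMaybe-nothing (x ∷ xs) () | just _

maxMaybe-just : ∀ xs {m} → maxMaybe xs ≡ just m → m ∈ xs × (∀ {x} → x ∈ xs → x ≤ m)
maxMaybe-just (x ∷ xs) e with maxMaybe xs in eq
maxMaybe-just (x ∷ xs) refl | nothing with refl ← maxMaybe-nothing xs eq =
  here refl , λ { (here refl) → ≤-refl }
maxMaybe-just (x ∷ xs) refl | just y with y∈ , ub ← maxMaybe-just xs eq =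
  [ (λ e → here e) , (λ e → there (subst (_∈ xs) (sym e) y∈)) ]′ (⊔-sel x y) ,
  λ { (here refl) → m≤m⊔n x y ; (there p) → ≤-trans (ub p) (m≤n⊔m x y) }

least : ∀ x xs → ∃[ y ] (y ∈ x ∷ xs × (∀ {z} → z ∈ x ∷ xs → y ≤ z))
least x [] = x , here refl , λ { (here refl) → ≤-refl }
least x (x' ∷ xs) with y , y∈ , lb ← least x' xs with ≤-total x y
... | inj₁ x≤y = x , here refl , λ { (here refl) → ≤-refl ; (there p) → ≤-trans x≤y (lb p) }
... | inj₂ y≤x = y , there y∈ , λ { (here refl) → y≤x ; (there p) → lb p }

occupied⁺ : ∀ {D r c k} → (r , c , k) ∈ D → T (occupied D r c)
occupied⁺ {r = r} {c} m =
  any⁺ _ (Any.map (λ { refl → Equivalence.from T-∧ (≡⇒≡ᵇ r r refl , ≡⇒≡ᵇ c c refl) }) m)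

occupied⁻ : ∀ D {r c} → T (occupied D r c) → ∃[ k ] (r , c , k) ∈ D
occupied⁻ D {r} {c} t with (r' , c' , k) , m , e ← find (any⁻ _ D t)
  with e₁ , e₂ ← Equivalence.to T-∧ e
  with refl ← ≡ᵇ⇒≡ r' r e₁ with refl ← ≡ᵇ⇒≡ c' c e₂ = k , m

filterᵇ-∷ʳ : ∀ {A : Set} (p : A → Bool) xs x →
             length (filterᵇ p (xs ++ x ∷ [])) ≡ (if p x then 1 else 0) + length (filterᵇ p xs)
filterᵇ-∷ʳ p xs x = begin
  length (filterᵇ p (xs ++ x ∷ []))                       ≡⟨ cong length (filter-++ (T? ∘ p) xs _) ⟩
  length (filterᵇ p xs ++ filterᵇ p (x ∷ []))             ≡⟨ length-++ (filterᵇ p xs) ⟩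
  length (filterᵇ p xs) + length (filterᵇ p (x ∷ []))     ≡⟨ +-comm (length (filterᵇ p xs)) _ ⟩
  length (filterᵇ p (x ∷ [])) + length (filterᵇ p xs)     ≡⟨ cong (_+ _) single ⟩
  (if p x then 1 else 0) + length (filterᵇ p xs)          ∎
  where
  open ≡-Reasoning
  single : length (filterᵇ p (x ∷ [])) ≡ (if p x then 1 else 0)
  single with p x
  ... | true = refl
  ... | false = refl

-- Finite sums and greatest deficits

∑ : (ℕ → ℕ) → ℕ → ℕ
∑ f zero = 0
∑ f (suc n) = f (suc n) + ∑ f n

_[_≔_] : (ℕ → ℕ) → ℕ → ℕ → ℕ → ℕ
(f [ k ≔ v ]) x with x ≟ k
... | yes _ = v
... | no _ = f x

≔-same : ∀ f k v → (f [ k ≔ v ]) k ≡ v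
≔-same f k v with k ≟ k
... | yes _ = refl
... | no k≢k = ⊥-elim (k≢k refl)

≔-other : ∀ f {k v x} → x ≢ k → (f [ k ≔ v ]) x ≡ f x
≔-other f {k} {v} {x} x≢k with x ≟ k
... | yes e = ⊥-elim (x≢k e)
... | no _ = refl

∑-≔-beyond : ∀ f {k v} n → n < k → ∑ (f [ k ≔ v ]) n ≡ ∑ f n
∑-≔-beyond f zero _ = refl
∑-≔-beyond f (suc n) n<k = cong₂ _+_ (≔-other f (<⇒≢ n<k)) (∑-≔-beyond f n (<-trans (n<1+n n) n<k))

-- The old value at `k` is dropped, and `k` may exceed `n`, hence only an inequality.
∑-≔-≤ : ∀ f k v n → ∑ (f [ k ≔ v ]) n ≤ v + ∑ f n
∑-≔-≤ f k v zero = z≤n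
∑-≔-≤ f k v (suc n) with suc n ≟ k
... | yes refl = +-monoʳ-≤ v (≤-trans (≤-reflexive (∑-≔-beyond f n ≤-refl)) (m≤n+m _ _))
... | no _ = begin
  f (suc n) + ∑ (f [ k ≔ v ]) n  ≤⟨ +-monoʳ-≤ (f (suc n)) (∑-≔-≤ f k v n) ⟩
  f (suc n) + (v + ∑ f n)        ≡⟨ x∙yz≈y∙xz (f (suc n)) v _ ⟩
  v + (f (suc n) + ∑ f n)        ∎
  where open ≤-Reasoning

-- `U` is the largest of the deficits n - f c, or 0 if none is positive. The last clause is
-- complementary slackness: a nonzero `U` makes some constraint tight.
maximal-deficit : ∀ n (f : ℕ → ℕ) cs →
  ∃[ U ] ((∀ {c} → c ∈ cs → n ≤ f c + U) × (U ≡ 0 ⊎ ∃[ c ] (c ∈ cs × f c + U ≡ n)))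
maximal-deficit n f [] = 0 , (λ ()) , inj₁ refl
maximal-deficit n f (c ∷ cs) with U , bound , attained ← maximal-deficit n f cs with n ≤? f c + U
... | yes p = U , (λ { (here refl) → p ; (there m) → bound m }) ,
  [ inj₁ , (λ { (c' , m , e) → inj₂ (c' , there m , e) }) ]′ attained
... | no ¬p = n ∸ f c ,
  (λ { (here refl) → ≤-reflexive (sym attained')
     ; (there {xs = _} m) → ≤-trans (bound m) (+-monoʳ-≤ _ U≤) }) ,
  inj₂ (c , here refl , attained')
  where
  fc+U≤n : f c + U ≤ n
  fc+U≤n = <⇒≤ (≰⇒> ¬p)
  attained' : f c + (n ∸ f c) ≡ n
  attained' = m+[n∸m]≡n (≤-trans (m≤m+n (f c) U) fc+U≤n)
  U≤ : U ≤ n ∸ f c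
  U≤ = ≤-trans (≤-reflexive (sym (m+n∸m≡n (f c) U))) (∸-monoˡ-≤ (f c) fc+U≤n)

-- Skew diagrams: weights of cells and a dual solution

module Skew (D : Diagram) (wfD : WellFormed D) (skew : GeneralizedSkew D) where
  open GeneralizedSkew skew

  cell⇒ord : ∀ {r c k} → (r , c , k) ∈ D → Ord D r c
  cell⇒ord {k = ordinary} m = m
  cell⇒ord {k = ghost} m = ⊥-elim (noGhost _ _ m)

  column-bound : ℕ
  column-bound = max 0 (map col D)

  ≤column-bound : ∀ {r c} → Ord D r c → c ≤ column-bound
  ≤column-bound o = All.lookup (xs≤max 0 (map col D)) (∈-map⁺ col o)

  leftmost : ∀ {r z} → Ord D r z → ∃[ a ] IsLeftmost D r a
  leftmost {r} m with candidates D r [] in eq | ∈-candidates⁺ D r [] m (λ ())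
  ... | x ∷ xs | _ with a , a∈ , lb ← least x xs =
    a , proj₁ (∈-candidates⁻ D r [] (subst (a ∈_) (sym eq) a∈)) ,
    λ p → lb (subst (_ ∈_) eq (∈-candidates⁺ D r [] p λ ()))

  rightmost : ∀ {r z} → Ord D r z → ∃[ b ] IsRightmost D r b
  rightmost {r} m with maxMaybe (candidates D r []) in eq
  ... | nothing with () ← subst (_ ∈_) (maxMaybe-nothing _ eq) (∈-candidates⁺ D r [] m (λ ()))
  ... | just b with b∈ , ub ← maxMaybe-just _ eq =
    b , proj₁ (∈-candidates⁻ D r [] b∈) , λ p → ub (∈-candidates⁺ D r [] p λ ())

  -- The only way in which skewness is used: a nonempty row between two rows
  -- i ≤ n contains every column between a column of n and a column of i.
  between : ∀ {i j n x y z t} → i ≤ j → j ≤ n → Ord D i y → Ord D n x → Ord D j z →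
            x ≤ t → t ≤ y → Ord D j t
  between {i} {j} {n} {x} {y} {z} {t} i≤j j≤n oi on oj x≤t t≤y
    with a , la@((_ , a∈) , a≤) ← leftmost oj | b , rb@((_ , b∈) , ≤b) ← rightmost oj
    with m≤n⇒m<n∨m≡n (≤-trans (a≤x j≤n la) x≤t) | m≤n⇒m<n∨m≡n (≤-trans t≤y (y≤b i≤j rb))
    where
    a≤x : j ≤ n → ∀ {a} → IsLeftmost D j a → a ≤ x
    a≤x j≤n la with m≤n⇒m<n∨m≡n j≤n | leftmost on
    ... | inj₁ j<n | a' , la' = ≤-trans (leftMono j<n la la') (proj₂ la' on)
    ... | inj₂ refl | _ = proj₂ la on
    y≤b : i ≤ j → ∀ {b} → IsRightmost D j b → y ≤ b
    y≤b i≤j rb with m≤n⇒m<n∨m≡n i≤j | rightmost oi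
    ... | inj₁ i<j | b' , rb' = ≤-trans (proj₂ rb' oi) (rightMono i<j rb' rb)
    ... | inj₂ refl | _ = proj₂ rb oi
  ... | inj₂ refl | _ = cell⇒ord a∈
  ... | inj₁ _ | inj₂ refl = cell⇒ord b∈
  ... | inj₁ a<t | inj₁ t<b = rowInterval la rb t a<t t<b

  nested : ∀ {j n c c'} → j ≤ n → c ≤ c' → Ord D n c → Ord D j c' → Ord D j c
  nested j≤n c≤c' on oj = between ≤-refl j≤n oj on oj ≤-refl c≤c'

  -- By `nested`, a row that has a cell in column `c'` has one in column `c` too. So within a row a
  -- cell further right has at least as much snow below it, which makes the dark cloud a heaviest
  -- unmarked cell.
  N-nested : ∀ {n c c'} x → x ≤ n → c ≤ c' → Ord D n c → N D c' x ≤ N D c x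
  N-nested zero _ _ _ = z≤n
  N-nested {n} {c} {c'} (suc x) x<n c≤c' on =
    +-mono-≤ χ≤ (N-nested x (<⇒≤ x<n) c≤c' on)
    where
    χ≤ : χ D (suc x) c' ≤ χ D (suc x) c
    χ≤ with (suc x , c' , ordinary) ∈? D
    ... | yes o = ≤-reflexive (sym (χ-in (nested x<n c≤c' on o)))
    ... | no _ = z≤n

  -- By `between`, each row above `i` and up to `n` meets both columns or neither. So the weights of
  -- the cells in columns `c` and `c'` differ by the same amount in rows `i` and `n`; this is the
  -- exchange property behind the greedy matching.
  N-parallel : ∀ {i n c c'} → i ≤ n → c ≤ c' → Ord D i c' → Ord D n c → Ord D n c' →
               N D c n + N D c' i ≡ N D c' n + N D c i
  N-parallel {i} {n} {c} {c'} i≤n c≤c' oi on on' = N-cong i n i≤n λ z i<z z≤n →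
    χ-cong {D} {D} (λ o → between (<⇒≤ i<z) z≤n oi on o c≤c' ≤-refl)
           (λ o → between (<⇒≤ i<z) z≤n oi on o ≤-refl c≤c')

  -- Each position of the column in rows 1..r is a snowflake or a cell, with (r,c) itself counted by
  -- `N`. So the snow below a cell is its weight.
  snow+N≡row : ∀ {r c} → Ord D r c → snowBelow D (r , c) + N D c r ≡ r
  snow+N≡row {zero} o with () ← row≥1 wfD o
  snow+N≡row {suc r} {c} o = begin
    empty r + N D c (suc r)  ≡⟨ cong (empty r +_) (N-suc-in o) ⟩
    empty r + suc (N D c r)  ≡⟨ +-suc (empty r) _ ⟩
    suc (empty r + N D c r)  ≡⟨ cong suc (empty+N r) ⟩
    suc r                    ∎
    where
    open ≡-Reasoning
    empty : ℕ → ℕ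
    empty n = length (filterᵇ (λ r' → not (occupied D r' c)) (rowsUpTo n))
    complement : ∀ z → (if not (occupied D z c) then 1 else 0) + χ D z c ≡ 1
    complement z with occupied D z c in eq
    ... | true = χ-in (cell⇒ord (proj₂ (occupied⁻ D (subst T (sym eq) _))))
    ... | false = cong suc (χ-out {D} (λ o → subst T eq (occupied⁺ {D} o)))
    empty+N : ∀ n → empty n + N D c n ≡ n
    empty+N zero = refl
    empty+N (suc n) = begin
      empty (suc n) + (χ D (suc n) c + N D c n)
        ≡⟨ cong (_+ N D c (suc n)) (filterᵇ-∷ʳ _ (rowsUpTo n) (suc n)) ⟩
      e + empty n + (χ D (suc n) c + N D c n)
        ≡⟨ interchange e (empty n) _ _ ⟩
      (e + χ D (suc n) c) + (empty n + N D c n)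
        ≡⟨ cong₂ _+_ (complement (suc n)) (empty+N n) ⟩
      suc n ∎
      where e = if not (occupied D (suc n) c) then 1 else 0

  snow : ℕ → List ℕ → ℕ
  snow r M = sum (map (snowBelow D) (cloudsFrom D r M))

  -- For a new row n with dark cloud in column m, u n is the least value that is
  -- feasible for the other columns of row n; v m is what remains of the weight of (n,m).
  dual : ∀ C r M → ∃[ u ] ∃[ v ]
    ( (∀ {c} → c ∈ M → v c ≡ 0)
    × (∀ {i c} → i ≤ r → c ∉ M → Ord D i c → i ≤ N D c i + (u i + v c))
    × ∑ u r + ∑ v C ≤ snow r M )
  dual C zero M = (λ _ → 0) , (λ _ → 0) , (λ _ → refl) ,
    (λ { z≤n _ o → z≤n }) , ≤-reflexive (∑0 C)
    where
    ∑0 : ∀ n → ∑ (λ _ → 0) n ≡ 0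
    ∑0 zero = refl
    ∑0 (suc n) = ∑0 n
  dual C (suc r) M with maxMaybe (candidates D (suc r) M) in eq
  ... | nothing with u , v , v0 , feasible , total ← dual C r M =
    u [ suc r ≔ 0 ] , v , v0 , feasible' ,
    ≤-trans (≤-reflexive (cong (_+ ∑ v C) (cong₂ _+_ (≔-same u (suc r) 0) (∑-≔-beyond u r ≤-refl)))) total
    where
    feasible' : ∀ {i c} → i ≤ suc r → c ∉ M → Ord D i c → i ≤ N D c i + ((u [ suc r ≔ 0 ]) i + v c)
    feasible' {i} {c} i≤ c∉M o with m≤n⇒m<n∨m≡n i≤
    ... | inj₁ (s≤s i≤r) rewrite ≔-other u {suc r} {0} (<⇒≢ (s≤s i≤r)) = feasible i≤r c∉M o
    ... | inj₂ refl with () ← subst (c ∈_) (maxMaybe-nothing _ eq) (∈-candidates⁺ D (suc r) M o c∉M)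
  ... | just m with u , v , v0 , feasible , total ← dual C r (m ∷ M)
               with U , bound , attained ← maximal-deficit (suc r) (λ c → N D c (suc r) + v c)
                                             (filter (λ c → ¬? (c ≟ m)) (candidates D (suc r) M)) =
    u' , v' , v'0 , feasible' , total'
    where
    n = suc r
    W = snowBelow D (n , m)
    V = W ∸ U
    u' = u [ n ≔ U ]
    v' = v [ m ≔ V ]
    m-cand = proj₁ (maxMaybe-just _ eq)
    m∉M = proj₂ (∈-candidates⁻ D (suc r) M m-cand)
    om : Ord D n m
    om = cell⇒ord (proj₂ (proj₁ (∈-candidates⁻ D (suc r) M m-cand)))
    ≤m : ∀ {c} → c ∉ M → Ord D n c → c ≤ m
    ≤m c∉M o = proj₂ (maxMaybe-just _ eq) (∈-candidates⁺ D (suc r) M o c∉M)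

    other : ∀ {c} → c ∈ filter (λ c → ¬? (c ≟ m)) (candidates D n M) → c ∉ m ∷ M × Ord D n c
    other c∈ with c∈' , c≢m ← ∈-filter⁻ (λ c → ¬? (c ≟ m)) c∈
             with (_ , o) , c∉M ← ∈-candidates⁻ D (suc r) M c∈' =
      (λ { (here e) → c≢m e ; (there p) → c∉M p }) , cell⇒ord o

    Attained : Set
    Attained = U ≡ 0 ⊎ ∃[ c ] (c ∈ filter (λ c → ¬? (c ≟ m)) (candidates D n M) × N D c n + v c + U ≡ n)

    -- A tight column `c` lies weakly left of `m`. By `N-nested` the weight `W` of (n,m) is at least
    -- that of (n,c), which is at least `U`; so the subtraction in `V` does not truncate.
    U≤W : Attained → U ≤ W
    U≤W (inj₁ U≡0) = ≤-trans (≤-reflexive U≡0) z≤n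
    U≤W (inj₂ (c , c∈ , e)) with c∉ , o ← other c∈ = +-cancelʳ-≤ (N D m n) U W (begin
      U + N D m n          ≤⟨ +-monoʳ-≤ U (N-nested n ≤-refl (≤m (c∉ ∘ there) o) o) ⟩
      U + N D c n          ≤⟨ +-monoʳ-≤ U (m≤m+n _ (v c)) ⟩
      U + (N D c n + v c)  ≡⟨ +-comm U _ ⟩
      N D c n + v c + U    ≡⟨ e ⟩
      n                    ≡⟨ sym (snow+N≡row om) ⟩
      W + N D m n          ∎)
      where open ≤-Reasoning

    U+V≡W : U + V ≡ W
    U+V≡W = m+[n∸m]≡n (U≤W attained)

    U+V+N≡n : U + V + N D m n ≡ n
    U+V+N≡n = trans (cong (_+ N D m n) U+V≡W) (snow+N≡row om)

    -- If `U` is 0, then `V` is the whole weight of (n,m), and weights do not decrease upwards in a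
    -- column. Otherwise the constraint at (i,c), for the tight column `c`, is carried over to
    -- (i,m): by `N-parallel` the weights change by the same amount as in row `n`, where both
    -- constraints are equalities.
    below : ∀ {i} → Attained → i ≤ r → Ord D i m → i ≤ N D m i + (u i + V)
    below {i} (inj₁ U≡0) i≤r o = +-cancelʳ-≤ n i _ (begin
      i + n                            ≡⟨ cong (i +_) (sym U+V+N≡n) ⟩
      i + (U + V + N D m n)            ≡⟨ cong (λ U → i + (U + V + N D m n)) U≡0 ⟩
      i + (V + N D m n)                ≡⟨ x∙yz≈y∙xz i V _ ⟩
      V + (i + N D m n)                ≤⟨ +-mono-≤ (m≤n+m V (u i)) (N-lipschitz D m (m≤n⇒m≤1+n i≤r)) ⟩
      u i + V + (n + N D m i)          ≡⟨ solve 3 (λ a n N → a :+ (n :+ N) := N :+ a :+ n) refl (u i + V) n (N D m i) ⟩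
      N D m i + (u i + V) + n          ∎)
      where
      open ≤-Reasoning
      open +-*-Solver
    below {i} (inj₂ (c , c∈ , e)) i≤r o with c∉ , oc ← other c∈ = +-cancelʳ-≤ n i _ (begin
      i + n
        ≡⟨ cong (i +_) (sym U+V+N≡n) ⟩
      i + (U + V + N D m n)
        ≤⟨ +-monoˡ-≤ (U + V + N D m n) (feasible i≤r c∉ (nested (m≤n⇒m≤1+n i≤r) c≤m oc o)) ⟩
      N D c i + (u i + v c) + (U + V + N D m n)
        ≡⟨ solve 6 (λ Nci ui vc U V Nmn → Nci :+ (ui :+ vc) :+ (U :+ V :+ Nmn)
                                       := (Nmn :+ Nci) :+ (ui :+ vc :+ U :+ V)) refl
             (N D c i) (u i) (v c) U V (N D m n) ⟩
      (N D m n + N D c i) + (u i + v c + U + V)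
        ≡⟨ cong (_+ (u i + v c + U + V)) (sym (N-parallel (m≤n⇒m≤1+n i≤r) c≤m o oc om)) ⟩
      (N D c n + N D m i) + (u i + v c + U + V)
        ≡⟨ solve 6 (λ Nmi ui vc U V Ncn → (Ncn :+ Nmi) :+ (ui :+ vc :+ U :+ V)
                                       := Nmi :+ (ui :+ V) :+ (Ncn :+ vc :+ U)) refl
             (N D m i) (u i) (v c) U V (N D c n) ⟩
      N D m i + (u i + V) + (N D c n + v c + U)
        ≡⟨ cong (N D m i + (u i + V) +_) e ⟩
      N D m i + (u i + V) + n ∎)
      where
      open ≤-Reasoning
      open +-*-Solver
      c≤m : c ≤ m
      c≤m = ≤m (c∉ ∘ there) oc

    v'0 : ∀ {c} → c ∈ M → v' c ≡ 0
    v'0 {c} c∈M = trans (≔-other v {m} λ { refl → m∉M c∈M }) (v0 (there c∈M))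

    feasible' : ∀ {i c} → i ≤ n → c ∉ M → Ord D i c → i ≤ N D c i + (u' i + v' c)
    feasible' {i} {c} i≤ c∉M o with m≤n⇒m<n∨m≡n i≤ | c ≟ m
    ... | inj₁ (s≤s i≤r) | yes refl rewrite ≔-other u {n} {U} (<⇒≢ (s≤s i≤r)) = below attained i≤r o
    ... | inj₁ (s≤s i≤r) | no c≢m rewrite ≔-other u {n} {U} (<⇒≢ (s≤s i≤r)) =
      feasible i≤r (λ { (here e) → c≢m e ; (there p) → c∉M p }) o
    ... | inj₂ refl | yes refl rewrite ≔-same u n U =
      ≤-reflexive (trans (sym U+V+N≡n) (+-comm (U + V) _))
    ... | inj₂ refl | no c≢m rewrite ≔-same u n U =
      ≤-trans (bound (∈-filter⁺ (λ c → ¬? (c ≟ m)) (∈-candidates⁺ D (suc r) M o c∉M) c≢m))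
        (≤-reflexive (trans (+-assoc (N D c n) (v c) U) (cong (N D c n +_) (+-comm (v c) U))))

    total' : ∑ u' n + ∑ v' C ≤ W + snow r (m ∷ M)
    total' = begin
      u' n + ∑ u' r + ∑ v' C     ≡⟨ cong (_+ ∑ v' C) (cong₂ _+_ (≔-same u n U) (∑-≔-beyond u r ≤-refl)) ⟩
      U + ∑ u r + ∑ v' C         ≤⟨ +-monoʳ-≤ (U + ∑ u r) (∑-≔-≤ v m V C) ⟩
      U + ∑ u r + (V + ∑ v C)    ≡⟨ interchange U (∑ u r) V _ ⟩
      U + V + (∑ u r + ∑ v C)    ≤⟨ +-mono-≤ (≤-reflexive U+V≡W) total ⟩
      W + snow r (m ∷ M)         ∎
      where open ≤-Reasoning

-- The effect of a move on column counts

record Move (E E' : Diagram) : Set where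
  field
    {r c rh} : ℕ
    moving : Ord E r c
    right-end : ∀ {c' k} → (r , c' , k) ∈ E → c' ≤ c
    rh≥1 : 1 ≤ rh
    rh<r : rh < r
    landing-empty : ∀ k → (rh , c , k) ∉ E
    jumped : ∀ z → rh < z → z < r → Ord E z c
    landed : Ord E' rh c
    ord⁺ : ∀ {x y} → Ord E x y → ¬ (x ≡ r × y ≡ c) → Ord E' x y
    ord⁻ : ∀ {x y} → Ord E' x y → (x ≡ rh × y ≡ c) ⊎ (Ord E x y × ¬ (x ≡ r × y ≡ c))
    ghost⁻ : ∀ {x y} → Ghost E' x y → Ghost E x y ⊎ (x ≡ r × y ≡ c)

WellFormed-kohnert : ∀ {r c rh k rest} → WellFormed ((r , c , k) ∷ rest) → 1 ≤ rh →
               (∀ k → (rh , c , k) ∉ rest) → WellFormed ((rh , c , ordinary) ∷ rest)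
WellFormed-kohnert {c = c} {rh} {rest = rest} (((_ , c≥1) ∷ ge) , (_ ∷ u)) rh≥1 empty =
  ((rh≥1 , c≥1) ∷ ge) , (All.tabulate fresh ∷ u)
  where
  fresh : ∀ {p} → p ∈ map pos rest → (rh , c) ≢ p
  fresh p∈ refl with (_ , _ , k) , q , refl ← ∈-map⁻ pos p∈ = empty k q

WellFormed-ghostMove : ∀ {r c rh rest} → WellFormed ((r , c , ordinary) ∷ rest) → 1 ≤ rh → rh < r →
             (∀ k → (rh , c , k) ∉ rest) → WellFormed ((rh , c , ordinary) ∷ (r , c , ghost) ∷ rest)
WellFormed-ghostMove {r} {c} {rh} {rest} wf@(ge , u) rh≥1 rh<r empty with WellFormed-kohnert wf rh≥1 empty
... | (g ∷ _) , (n ∷ _) = (g ∷ retype ge) , (((λ { refl → <-irrefl refl rh<r }) ∷ n) ∷ u)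
  where
  retype : All (λ x → 1 ≤ row x × 1 ≤ col x) ((r , c , ordinary) ∷ rest) →
           All (λ x → 1 ≤ row x × 1 ≤ col x) ((r , c , ghost) ∷ rest)
  retype (a ∷ as) = a ∷ as

module _ {E r c rh rest} (wf : WellFormed E) (E↭ : E ↭ (r , c , ordinary) ∷ rest)
         (right : ∀ {c' k} → (r , c' , k) ∈ E → c' ≤ c) (rh≥1 : 1 ≤ rh) (rh<r : rh < r)
         (empty : ∀ k → (rh , c , k) ∉ E) (run : ∀ z → rh < z → z < r → Ord E z c) where
  private
    wf' : WellFormed ((r , c , ordinary) ∷ rest)
    wf' = WellFormed-resp-↭ E↭ wf

    back : ∀ {x} → x ∈ rest → x ∈ E
    back p = Perm.∈-resp-↭ (↭-sym E↭) (there p)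

    keep : ∀ {x y} → Ord E x y → ¬ (x ≡ r × y ≡ c) → (x , y , ordinary) ∈ rest
    keep o ≢ with Perm.∈-resp-↭ E↭ o
    ... | here refl = ⊥-elim (≢ (refl , refl))
    ... | there p = p

    kept : ∀ {x y k} → (x , y , k) ∈ rest → ¬ (x ≡ r × y ≡ c)
    kept p (refl , refl) = All.lookup (AllPairs.head (proj₂ wf')) (∈-map⁺ pos p) refl

  kohnert⇒Move : WellFormed ((rh , c , ordinary) ∷ rest) × Move E ((rh , c , ordinary) ∷ rest)
  kohnert⇒Move = WellFormed-kohnert wf' rh≥1 (λ k → empty k ∘ back) , record
    { moving = Perm.∈-resp-↭ (↭-sym E↭) (here refl) ; right-end = right
    ; rh≥1 = rh≥1 ; rh<r = rh<r ; landing-empty = empty ; jumped = run ; landed = here refl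
    ; ord⁺ = λ o ≢ → there (keep o ≢)
    ; ord⁻ = λ { (here refl) → inj₁ (refl , refl) ; (there p) → inj₂ (back p , kept p) }
    ; ghost⁻ = λ { (there p) → inj₁ (back p) } }

  ghostMove⇒Move : WellFormed ((rh , c , ordinary) ∷ (r , c , ghost) ∷ rest) ×
                   Move E ((rh , c , ordinary) ∷ (r , c , ghost) ∷ rest)
  ghostMove⇒Move = WellFormed-ghostMove wf' rh≥1 rh<r (λ k → empty k ∘ back) , record
    { moving = Perm.∈-resp-↭ (↭-sym E↭) (here refl) ; right-end = right
    ; rh≥1 = rh≥1 ; rh<r = rh<r ; landing-empty = empty ; jumped = run ; landed = here refl
    ; ord⁺ = λ o ≢ → there (there (keep o ≢))
    ; ord⁻ = λ { (here refl) → inj₁ (refl , refl) ; (there (there p)) → inj₂ (back p , kept p) }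
    ; ghost⁻ = λ { (there (here refl)) → inj₂ (refl , refl) ; (there (there p)) → inj₁ (back p) } }

step⇒Move : ∀ {E E'} → WellFormed E → Step E E' → WellFormed E' × Move E E'
step⇒Move wf (kohnert E↭ right rh≥1 rh<r empty run) = kohnert⇒Move wf E↭ right rh≥1 rh<r (λ k → empty k) run
step⇒Move wf (ghostMove E↭ right rh≥1 rh<r empty run) = ghostMove⇒Move wf E↭ right rh≥1 rh<r (λ k → empty k) run

module MoveCount {E E'} (move : Move E E') where
  open Move move

  χ-fixed : ∀ {x y} → ¬ (x ≡ r × y ≡ c) → ¬ (x ≡ rh × y ≡ c) → χ E' x y ≡ χ E x y
  χ-fixed ≢r ≢rh = χ-cong {E'} {E}
    (λ o → [ (λ e → ⊥-elim (≢rh e)) , proj₁ ]′ (ord⁻ o)) (λ o → ord⁺ o ≢r)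

  N-other : ∀ {y} x → y ≢ c → N E' y x ≡ N E y x
  N-other zero _ = refl
  N-other (suc x) y≢c = cong₂ _+_ (χ-fixed (y≢c ∘ proj₂) (y≢c ∘ proj₂)) (N-other x y≢c)

  N-below : ∀ x → x < rh → N E' c x ≡ N E c x
  N-below zero _ = refl
  N-below (suc x) x<rh = cong₂ _+_
    (χ-fixed (λ { (refl , _) → <-asym x<rh rh<r }) (λ { (refl , _) → <-irrefl refl x<rh }))
    (N-below x (<-trans (n<1+n x) x<rh))

  N-jumped : ∀ x → rh ≤ x → x < r → N E' c x ≡ suc (N E c x)
  N-jumped zero rh≤ _ with () ← ≤-trans rh≥1 rh≤
  N-jumped (suc x) rh≤ x<r with m≤n⇒m<n∨m≡n rh≤
  ... | inj₂ refl = trans (N-suc-in landed)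
                      (cong suc (trans (N-below x ≤-refl) (sym (N-suc-out {E} (landing-empty ordinary)))))
  ... | inj₁ rh<@(s≤s rh≤x) = trans (cong₂ _+_
      (χ-fixed (λ { (refl , _) → <-irrefl refl x<r }) (λ { (refl , _) → <-irrefl refl rh< }))
      (N-jumped x rh≤x (<-trans (n<1+n x) x<r)))
    (+-suc (χ E (suc x) c) _)

  N-above : ∀ x → r ≤ x → N E' c x ≡ N E c x
  N-above zero r≤ with () ← ≤-trans rh<r r≤
  N-above (suc x) r≤ with m≤n⇒m<n∨m≡n r≤
  ... | inj₂ refl = trans (N-suc-out {E'} λ o → [ (λ { (refl , _) → <-irrefl refl rh<r })
                                               , (λ { (_ , ≢) → ≢ (refl , refl) }) ]′ (ord⁻ o))
                      (trans (N-jumped x (≤-pred rh<r) ≤-refl) (sym (N-suc-in moving)))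
  ... | inj₁ r<@(s≤s r≤x) = cong₂ _+_
    (χ-fixed (λ { (refl , _) → <-irrefl refl r< }) (λ { (refl , _) → <-asym r< rh<r }))
    (N-above x r≤x)

  -- The cell leaves row `r` and lands in row `rh`, so only the counts at heights from `rh` to r - 1
  -- gain one.
  N-changed : ∀ y x → N E' y x ≡ N E y x ⊎ (y ≡ c × rh ≤ x × x < r × N E' y x ≡ suc (N E y x))
  N-changed y x with y ≟ c
  ... | no y≢c = inj₁ (N-other x y≢c)
  ... | yes refl with x <? rh | x <? r
  ...   | yes x<rh | _ = inj₁ (N-below x x<rh)
  ...   | no ¬x<rh | yes x<r = inj₂ (refl , ≮⇒≥ ¬x<rh , x<r , N-jumped x (≮⇒≥ ¬x<rh) x<r)
  ...   | no _ | no ¬x<r = inj₁ (N-above x (≮⇒≥ ¬x<r))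

  N-grows : ∀ y x → N E y x ≤ N E' y x
  N-grows y x with N-changed y x
  ... | inj₁ e = ≤-reflexive (sym e)
  ... | inj₂ (_ , _ , _ , e) = ≤-trans (n≤1+n _) (≤-reflexive (sym e))

-- Pigeonhole principle and slots

row≤maxRow : ∀ {D r c k} → (r , c , k) ∈ D → r ≤ maxRow D
row≤maxRow {x ∷ D} (here refl) = m≤m⊔n _ _
row≤maxRow {x ∷ D} (there p) = ≤-trans (row≤maxRow p) (m≤n⊔m (row x) _)

-- The partner of the first element is cut out of `ys`; by injectivity no later element has it as
-- partner, so the induction goes on with the shorter list.
pigeonhole : ∀ {A B : Set} (R : A → B → Set) xs ys → Unique xs →
             (∀ {x} → x ∈ xs → ∃[ y ] (y ∈ ys × R x y)) →
             (∀ {x x' y} → R x y → R x' y → x ≡ x') → length xs ≤ length ys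
pigeonhole R [] ys _ _ _ = z≤n
pigeonhole R (x ∷ xs) ys (x≢ ∷ u) place inj
  with y , y∈ , xy ← place (here refl) with ys₁ , ys₂ , refl ← ∈-∃++ y∈ = begin
  suc (length xs)            ≤⟨ s≤s (pigeonhole R xs (ys₁ ++ ys₂) u place' inj) ⟩
  suc (length (ys₁ ++ ys₂))  ≡⟨ sym (Perm.↭-length (Perm.shift y ys₁ ys₂)) ⟩
  length (ys₁ ++ y ∷ ys₂)    ∎
  where
  open ≤-Reasoning
  place' : ∀ {x'} → x' ∈ xs → ∃[ y' ] (y' ∈ ys₁ ++ ys₂ × R x' y')
  place' x'∈ with y' , y'∈ , x'y' ← place (there x'∈)
             with Perm.∈-resp-↭ (Perm.shift y ys₁ ys₂) y'∈
  ... | here refl = ⊥-elim (All.lookup x≢ x'∈ (inj xy x'y'))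
  ... | there p = y' , p , x'y'

pair : ℕ → ℕ → ℕ × ℕ
pair = _,_

level : (ℕ → ℕ) → ℕ → List (ℕ × ℕ)
level f k = map (pair k) (upTo (f k))

-- The pairs (k,t) with 1 ≤ k ≤ n and t < f k: a set of `∑ f n` places into which ghosts can be
-- injected.
slots : (ℕ → ℕ) → ℕ → List (ℕ × ℕ)
slots f zero = []
slots f (suc n) = level f (suc n) ++ slots f n

length-slots : ∀ f n → length (slots f n) ≡ ∑ f n
length-slots f zero = refl
length-slots f (suc n) = trans (length-++ (level f (suc n)))
  (cong₂ _+_ (trans (length-map (pair (suc n)) (upTo (f (suc n)))) (length-upTo (f (suc n)))) (length-slots f n))

∈-slots : ∀ f n {k t} → 1 ≤ k → k ≤ n → t < f k → (k , t) ∈ slots f n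
∈-slots f zero () z≤n _
∈-slots f (suc n) 1≤k k≤n t< with m≤n⇒m<n∨m≡n k≤n
... | inj₁ (s≤s k≤n') = ∈-++⁺ʳ (level f (suc n)) (∈-slots f n 1≤k k≤n' t<)
... | inj₂ refl = ∈-++⁺ˡ (∈-map⁺ (pair (suc n)) (∈-upTo⁺ t<))

-- Upper bound: labels of ghosts and their slots

module UpperBound (D : Diagram) (wfD : WellFormed D) (skew : GeneralizedSkew D) where
  open GeneralizedSkew skew using (noGhost)
  open Skew D wfD skew

  K : ℕ
  K = maxRow D

  -- Within a column the ordinary cells keep their order, so the m-th ordinary
  -- cell of column c in E is identified with the m-th cell of column c in D.
  -- A ghost at (g,c) carries the label i when the cell that left it there comes
  -- from (i,c), that is N E c g ≡ N D c i.
  record Invariant (E : Diagram) : Set where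
    field
      wf : WellFormed E
      descending : ∀ y x → N D y x ≤ N E y x
      conserved : ∀ y x → N E y x ≤ N D y K
      -- The right one of two cells coming from one row of D is weakly below the left one.
      aligned : ∀ {i c c'} x → c < c' → Ord D i c → Ord D i c' →
                N D c i ≤ N E c x → N D c' i ≤ N E c' x
      labels-differ : ∀ {g c c' i} → c < c' → Ghost E g c → Ghost E g c' → Ord D i c → Ord D i c' →
                      N E c g ≡ N D c i → N E c' g ≡ N D c' i → ⊥
      ghost-above : ∀ {g c} → Ghost E g c → N D c (g ∸ 1) < N E c g

  N-D≤ : ∀ y x → N D y x ≤ N D y K
  N-D≤ y zero = z≤n
  N-D≤ y (suc x) with (suc x , y , ordinary) ∈? D
  ... | no _ = N-D≤ y x
  ... | yes o = subst (_≤ N D y K) (N-suc-in o) (N-mono D y (row≤maxRow o))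

  initial : Invariant D
  initial = record
    { wf = wfD
    ; descending = λ y x → ≤-refl
    ; conserved = N-D≤
    ; aligned = λ {_} {_} {c'} x _ o o' le → N-mono D c' {y = x} (N-cell-inj (row≥1 wfD o) o le)
    ; labels-differ = λ _ g _ _ _ _ _ → noGhost _ _ g
    ; ghost-above = λ g → ⊥-elim (noGhost _ _ g) }

  preserved : ∀ {E E'} → Invariant E → Step E E' → Invariant E'
  preserved {E} {E'} inv step with step⇒Move (Invariant.wf inv) step
  ... | wf' , move = record
    { wf = wf'
    ; descending = λ y x → ≤-trans (descending y x) (N-grows y x)
    ; conserved = conserved'
    ; aligned = aligned'
    ; labels-differ = labels-differ'
    ; ghost-above = ghost-above' }
    where
    open Invariant inv
    open Move move renaming (c to c₀)
    open MoveCount move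

    r≥1 : 1 ≤ r
    r≥1 = ≤-trans rh≥1 (<⇒≤ rh<r)

    -- Where the count gains one, the moving cell was still above height `x`, so `N E y x` was
    -- smaller than `N E y r`.
    conserved' : ∀ y x → N E' y x ≤ N D y K
    conserved' y x with N-changed y x
    ... | inj₁ e = ≤-trans (≤-reflexive e) (conserved y x)
    ... | inj₂ (refl , _ , x<r , e) =
      ≤-trans (≤-reflexive e) (≤-trans (N-below-cell x<r moving) (conserved y r))

    -- Labels are permanent: a change at height `g` would need the ghost to lie at the empty landing
    -- position or among the jumped cells, which are ordinary.
    N-at-ghost : ∀ {g y} → Ghost E' g y → N E' y g ≡ N E y g
    N-at-ghost {g} {y} gh with ghost⁻ gh
    ... | inj₂ (refl , refl) = N-above g ≤-refl
    ... | inj₁ gh' with N-changed y g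
    ...   | inj₁ e = e
    ...   | inj₂ (refl , rh≤g , g<r , _) with m≤n⇒m<n∨m≡n rh≤g
    ...     | inj₁ rh<g = ⊥-elim (ord∧ghost⇒⊥ wf (jumped g rh<g g<r) gh')
    ...     | inj₂ refl = ⊥-elim (landing-empty ghost gh')

    -- The case that matters is the one where the move lets the cell of label `i` in column `c` sink
    -- to height `x` or lower. Then rows x + 1..r of column `c` are a run of cells, whose top stems
    -- from a row `i₂`. As row `r` has no cell in column `c'`, the partner of the top lies in row r
    -- - 1 or lower. By `N-parallel` it comes r - 1 - x places after the partner of label `i` in
    -- column `c'`, which therefore lies in row `x` or lower.
    aligned' : ∀ {i c c'} x → c < c' → Ord D i c → Ord D i c' →
               N D c i ≤ N E' c x → N D c' i ≤ N E' c' x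
    aligned' {i} {c} {c'} x c<c' o o' le with N-changed c x
    ... | inj₁ e = ≤-trans (aligned x c<c' o o' (subst (_ ≤_) e le)) (N-grows c' x)
    ... | inj₂ (refl , rh≤x , x<r , e) with N D c i ≤? N E c x
    ...   | yes p = ≤-trans (aligned x c<c' o o' p) (N-grows c' x)
    ...   | no ¬p = ≤-trans (+-cancelʳ-≤ (x + N E c r) _ _ combined) (N-grows c' x)
      where
      r' = r ∸ 1
      i-at : N D c i ≡ suc (N E c x)
      i-at = ≤-antisym (subst (_ ≤_) e le) (≰⇒> ¬p)
      -- the cell at the top of the run of cells that is jumped
      top = nth-cell D c K (N E c r) (≤-trans (s≤s z≤n) (N-below-cell x<r moving)) (conserved c r)
      i₂ = proj₁ top
      o₂ : Ord D i₂ c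
      o₂ = proj₁ (proj₂ (proj₂ (proj₂ top)))
      top-at : N D c i₂ ≡ N E c r
      top-at = proj₂ (proj₂ (proj₂ (proj₂ top)))
      i≤i₂ : i ≤ i₂
      i≤i₂ = N-cell-inj (row≥1 wfD o) o
        (≤-trans (≤-reflexive i-at) (≤-trans (N-below-cell x<r moving) (≤-reflexive (sym top-at))))
      o₂' : Ord D i₂ c'
      o₂' = between i≤i₂ ≤-refl o' o₂ o₂ (<⇒≤ c<c') ≤-refl
      top-right : N D c' i₂ ≤ N E c' r'
      top-right = ≤-trans (aligned r c<c' o₂ o₂' (≤-reflexive top-at))
        (≤-reflexive (N-out {E} r (λ o → <⇒≱ c<c' (right-end o))))
      run : x + N E c r ≡ r + N E c x
      run = N-full E c (<⇒≤ x<r) λ z x<z z≤r →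
        [ jumped z (≤-<-trans rh≤x x<z) , (λ { refl → moving }) ]′ (m≤n⇒m<n∨m≡n z≤r)
      x≤r' : x ≤ r'
      x≤r' = ≤-pred (≤-trans x<r (≤-reflexive (sym (suc[x∸1] r≥1))))
      combined : N D c' i + (x + N E c r) ≤ N E c' x + (x + N E c r)
      combined = begin
        N D c' i + (x + N E c r)
          ≡⟨ solve 3 (λ a x b → a :+ (x :+ b) := x :+ (b :+ a)) refl (N D c' i) x (N E c r) ⟩
        x + (N E c r + N D c' i)
          ≡⟨ cong (λ b → x + (b + N D c' i)) (sym top-at) ⟩
        x + (N D c i₂ + N D c' i)
          ≡⟨ cong (x +_) (N-parallel i≤i₂ (<⇒≤ c<c') o' o₂ o₂') ⟩
        x + (N D c' i₂ + N D c i)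
          ≤⟨ +-monoʳ-≤ x (+-mono-≤ top-right (≤-reflexive i-at)) ⟩
        x + (N E c' r' + suc (N E c x))
          ≡⟨ sym (+-assoc x _ _) ⟩
        x + N E c' r' + suc (N E c x)
          ≤⟨ +-monoˡ-≤ _ (N-lipschitz E c' x≤r') ⟩
        r' + N E c' x + suc (N E c x)
          ≡⟨ solve 3 (λ r a b → r :+ a :+ (con 1 :+ b) := a :+ ((con 1 :+ r) :+ b)) refl r' (N E c' x) (N E c x) ⟩
        N E c' x + (suc r' + N E c x)
          ≡⟨ cong (λ r → N E c' x + (r + N E c x)) (suc[x∸1] r≥1) ⟩
        N E c' x + (r + N E c x)
          ≡⟨ cong (N E c' x +_) (sym run) ⟩
        N E c' x + (x + N E c r) ∎
        where
        open ≤-Reasoning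
        open +-*-Solver

    -- A new ghost cannot be left of an old one, since its cell was rightmost in the row. If it is
    -- right of an old one with the same label, then `aligned` at height r - 1 puts the cell that
    -- has just left row `r` strictly below row `r` already before the move.
    labels-differ' : ∀ {g c c' i} → c < c' → Ghost E' g c → Ghost E' g c' → Ord D i c → Ord D i c' →
                     N E' c g ≡ N D c i → N E' c' g ≡ N D c' i → ⊥
    labels-differ' {g} {c} {c'} {i} c<c' gh gh' o o' e e' with ghost⁻ gh | ghost⁻ gh'
    ... | inj₁ h | inj₁ h' =
      labels-differ c<c' h h' o o' (trans (sym (N-at-ghost gh)) e) (trans (sym (N-at-ghost gh')) e')
    ... | inj₁ h | inj₂ (refl , refl) = <-irrefl refl (begin-strict
      N D c' i           ≤⟨ aligned (r ∸ 1) c<c' o o' (≤-reflexive (sym left-at)) ⟩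
      N E c' (r ∸ 1)     <⟨ n<1+n _ ⟩
      suc (N E c' (r ∸ 1)) ≡⟨ sym (N-in r r≥1 moving) ⟩
      N E c' r           ≡⟨ sym (N-at-ghost gh') ⟩
      N E' c' r          ≡⟨ e' ⟩
      N D c' i           ∎)
      where
      open ≤-Reasoning
      left-at : N E c (r ∸ 1) ≡ N D c i
      left-at = trans (sym (N-out {E} r (λ o → ord∧ghost⇒⊥ wf o h))) (trans (sym (N-at-ghost gh)) e)
    ... | inj₂ (refl , refl) | inj₁ h' = <⇒≱ c<c' (right-end h')
    ... | inj₂ (refl , refl) | inj₂ (_ , refl) = <-irrefl refl c<c'

    -- For a new ghost: by `descending`, column `c` of `E` has below row `r` at least as many cells
    -- as `D` has there, and the moving cell is one more.
    ghost-above' : ∀ {g c} → Ghost E' g c → N D c (g ∸ 1) < N E' c g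
    ghost-above' {g} {c} gh with ghost⁻ gh
    ... | inj₁ h = subst (N D c (g ∸ 1) <_) (sym (N-at-ghost gh)) (ghost-above h)
    ... | inj₂ (refl , refl) = begin
      suc (N D c (r ∸ 1))  ≤⟨ s≤s (descending c (r ∸ 1)) ⟩
      suc (N E c (r ∸ 1))  ≡⟨ sym (N-in r r≥1 moving) ⟩
      N E c r              ≡⟨ sym (N-at-ghost gh) ⟩
      N E' c r             ∎
      where open ≤-Reasoning

  reachable : ∀ {E E'} → Invariant E → InKKD E E' → Invariant E'
  reachable inv ε = inv
  reachable inv (s ◅ ss) = reachable (preserved inv s) ss

  -- g − N E c g is the number of non-ordinary positions of column c in rows 1..g.
  data Slot (E : Diagram) : Cell → (ℕ × ℕ) ⊎ (ℕ × ℕ) → Set where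
    by-row : ∀ {g c i t} → Ghost E g c → Ord D i c → N E c g ≡ N D c i → g + t ≡ i →
             Slot E (g , c , ghost) (inj₁ (i , t))
    by-column : ∀ {g c h} → Ghost E g c → h + suc (N E c g) ≡ g →
                Slot E (g , c , ghost) (inj₂ (c , h))

  -- The upper ghost is itself a non-ordinary position, so the number of non-ordinary positions up
  -- to its row is strictly larger than at the lower one.
  ranks-differ : ∀ {E} → Invariant E → ∀ {g g' c h} → g < g' → Ghost E g' c →
             h + suc (N E c g) ≡ g → h + suc (N E c g') ≡ g' → ⊥
  ranks-differ {E} inv {g} {g'} {c} {h} g<g' gh' q q' = <-irrefl refl (begin-strict
    h + (N E c g + N E c g')        <⟨ n<1+n _ ⟩
    suc (h + (N E c g + N E c g'))  ≡⟨ solve 3 (λ h a b → con 1 :+ (h :+ (a :+ b)) := h :+ (con 1 :+ a) :+ b) refl h (N E c g) (N E c g') ⟩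
    h + suc (N E c g) + N E c g'    ≡⟨ cong₂ _+_ q (N-out {E} g' (λ o → ord∧ghost⇒⊥ (Invariant.wf inv) o gh')) ⟩
    g + N E c (g' ∸ 1)              ≤⟨ N-lipschitz E c (<⇒≤pred g<g') ⟩
    (g' ∸ 1) + N E c g              ≡⟨ cong (_+ N E c g) (cong (_∸ 1) (trans (sym q') (+-suc h _))) ⟩
    h + N E c g' + N E c g          ≡⟨ solve 3 (λ h a b → h :+ b :+ a := h :+ (a :+ b)) refl h (N E c g) (N E c g') ⟩
    h + (N E c g + N E c g')        ∎)
    where
    open ≤-Reasoning
    open +-*-Solver

  -- For row slots, equal `i` and `t` force equal `g`, and `labels-differ` excludes two columns. For
  -- column slots, `ranks-differ` excludes two rows.
  slot-injective : ∀ {E} → Invariant E → ∀ {x x' s} → Slot E x s → Slot E x' s → x ≡ x'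
  slot-injective {E} inv (by-row {g} {c} {t = t} gh o e q) (by-row {g'} {c'} gh' o' e' q')
    with refl ← +-cancelʳ-≡ t g g' (trans q (sym q')) with <-cmp c c'
  ... | tri< c<c' _ _ = ⊥-elim (Invariant.labels-differ inv c<c' gh gh' o o' e e')
  ... | tri≈ _ refl _ = refl
  ... | tri> _ _ c>c' = ⊥-elim (Invariant.labels-differ inv c>c' gh' gh o' o e' e)
  slot-injective {E} inv (by-column {g} {c} {h} gh q) (by-column {g'} gh' q') with <-cmp g g'
  ... | tri< g<g' _ _ = ⊥-elim (ranks-differ inv g<g' gh' q q')
  ... | tri≈ _ refl _ = refl
  ... | tri> _ _ g>g' = ⊥-elim (ranks-differ inv g>g' gh q' q)

  -- A label below row `g` would count at most the cells of `D` in rows 1..g - 1, which are too few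
  -- by `ghost-above`.
  ghost-below-label : ∀ {E} → Invariant E → ∀ {g c i} → Ghost E g c → N D c i ≡ N E c g → g ≤ i
  ghost-below-label inv {c = c} gh e = ≮⇒≥ λ i<g → <⇒≱ (Invariant.ghost-above inv gh)
    (≤-trans (≤-reflexive (sym e)) (N-mono D c (<⇒≤pred i<g)))

  -- With m = N E c g = N D c i, feasibility reads i ≤ m + u i + v c. If i - g is not below `u i`,
  -- this leaves g - m ≤ v c, so the rank h = g - m - 1 is below `v c`.
  ghost-slot : ∀ {E} → Invariant E → ∀ {u v : ℕ → ℕ} →
               (∀ {i c} → Ord D i c → i ≤ N D c i + (u i + v c)) →
               ∀ {x} → x ∈ filterᵇ isGhost E →
               ∃[ s ] (s ∈ map inj₁ (slots u K) ++ map inj₂ (slots v column-bound) × Slot E x s)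
  ghost-slot {E} inv {u} {v} feasible {g , c , ordinary} x∈ with () ← proj₂ (∈-filter⁻ (T? ∘ isGhost) {xs = E} x∈)
  ghost-slot {E} inv {u} {v} feasible {g , c , ghost} x∈
    with gh ← proj₁ (∈-filter⁻ (T? ∘ isGhost) {xs = E} x∈)
    with i , 1≤i , i≤K , o , e ← nth-cell D c K (N E c g)
           (≤-trans (s≤s z≤n) (Invariant.ghost-above inv gh)) (Invariant.conserved inv c g)
    with i ∸ g <? u i
  ... | yes t< = inj₁ (i , i ∸ g) , ∈-++⁺ˡ (∈-map⁺ inj₁ (∈-slots u K 1≤i i≤K t<)) ,
                 by-row gh o (sym e) (m+[n∸m]≡n (ghost-below-label inv gh e))
  ... | no t≮ = inj₂ (c , h) ,
                ∈-++⁺ʳ (map inj₁ (slots u K)) (∈-map⁺ inj₂ (∈-slots v column-bound (col≥1 wfD o) (≤column-bound o) h<)) ,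
                by-column gh h-eq
    where
    open Invariant inv
    g≤i : g ≤ i
    g≤i = ghost-below-label inv gh e
    m = N E c g
    h = g ∸ suc m
    m<g : m < g
    m<g = begin-strict
      m              ≡⟨ N-out {E} g (λ o → ord∧ghost⇒⊥ wf o gh) ⟩
      N E c (g ∸ 1)  ≤⟨ N≤ E c (g ∸ 1) ⟩
      g ∸ 1          <⟨ n<1+n _ ⟩
      suc (g ∸ 1)    ≡⟨ suc[x∸1] (row≥1 wf gh) ⟩
      g              ∎
      where open ≤-Reasoning
    h-eq : h + suc m ≡ g
    h-eq = m∸n+n≡m m<g
    h< : h < v c
    h< = +-cancelʳ-≤ (m + u i) (suc h) (v c) (begin
      suc h + (m + u i)        ≡⟨ solve 3 (λ h m u → (con 1 :+ h) :+ (m :+ u) := (h :+ (con 1 :+ m)) :+ u) refl h m (u i) ⟩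
      (h + suc m) + u i        ≡⟨ cong (_+ u i) h-eq ⟩
      g + u i                  ≤⟨ +-monoʳ-≤ g (≮⇒≥ t≮) ⟩
      g + (i ∸ g)              ≡⟨ m+[n∸m]≡n g≤i ⟩
      i                        ≤⟨ feasible o ⟩
      N D c i + (u i + v c)    ≡⟨ cong (_+ (u i + v c)) e ⟩
      m + (u i + v c)          ≡⟨ solve 3 (λ m u v → m :+ (u :+ v) := v :+ (m :+ u)) refl m (u i) (v c) ⟩
      v c + (m + u i)          ∎)
      where
      open ≤-Reasoning
      open +-*-Solver

  -- Weak duality: the ghosts inject into the slots, whose number is the value of the dual solution.
  ghosts≤sf : ∀ {E} → InKKD D E → ghosts E ≤ sf D
  ghosts≤sf {E} path = bounded (dual C K [])
    where
    inv = reachable initial path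
    C = column-bound
    bounded : _ → ghosts E ≤ sf D
    bounded (u , v , _ , feasible , total) = begin
      ghosts E
        ≤⟨ pigeonhole (Slot E) _ (map inj₁ (slots u K) ++ map inj₂ (slots v C))
             (Uniqueₚ.filter⁺ (T? ∘ isGhost) (Uniqueₚ.map⁻ (proj₂ (Invariant.wf inv))))
             (ghost-slot inv λ o → feasible (row≤maxRow o) (λ ()) o)
             (slot-injective inv) ⟩
      length (map inj₁ (slots u K) ++ map inj₂ (slots v C))
        ≡⟨ trans (length-++ (map inj₁ (slots u K)))
                 (cong₂ _+_ (trans (length-map inj₁ (slots u K)) (length-slots u K))
                            (trans (length-map inj₂ (slots v C)) (length-slots v C))) ⟩
      ∑ u K + ∑ v C
        ≤⟨ total ⟩
      sf D ∎
      where open ≤-Reasoning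

-- Letting one cell fall by unit moves

ghosts-↭ : ∀ {E E'} → E ↭ E' → ghosts E ≡ ghosts E'
ghosts-↭ p = Perm.↭-length (Perm.filter-↭ (T? ∘ isGhost) p)

tally : Bool → ℕ → ℕ
tally g n = if g then n else 0

-- The flag g selects the ghost move instead of the Kohnert move.
record OneDown (g : Bool) (E : Diagram) (x y : ℕ) : Set where
  field
    {E'} : Diagram
    step : Step E E'
    wf' : WellFormed E'
    landed : Ord E' x y
    tallied : ghosts E' ≡ tally g 1 + ghosts E
    kept : ∀ {z c k} → (z , c , k) ∈ E → ¬ (c ≡ y × z ≡ suc x) → (z , c , k) ∈ E'
    cells⁻ : ∀ {z c k} → (z , c , k) ∈ E' →
             (c ≡ y × z ≡ x) ⊎ (T g × c ≡ y × z ≡ suc x) ⊎ ((z , c , k) ∈ E × ¬ (c ≡ y × z ≡ suc x))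

one-down : ∀ g {E x y} → WellFormed E → Ord E (suc x) y → 1 ≤ x →
           (∀ {c k} → (suc x , c , k) ∈ E → c ≤ y) → (∀ k → (x , y , k) ∉ E) → OneDown g E x y
one-down g {x = x} {y} wf o x≥1 right empty with as , bs , refl ← ∈-∃++ o = result g
  where
  E = as ++ (suc x , y , ordinary) ∷ bs
  rest = as ++ bs
  E↭ : E ↭ (suc x , y , ordinary) ∷ rest
  E↭ = Perm.shift _ as bs
  -- No row lies strictly between `x` and `suc x`: a unit move jumps nothing, so no ghost can block
  -- it.
  run : ∀ z → x < z → z < suc x → Ord E z y
  run z p q = ⊥-elim (<-irrefl refl (<-≤-trans p (≤-pred q)))
  in-rest : ∀ {z c k} → (z , c , k) ∈ E → ¬ (c ≡ y × z ≡ suc x) → (z , c , k) ∈ rest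
  in-rest p ≢ with Perm.∈-resp-↭ E↭ p
  ... | here refl = ⊥-elim (≢ (refl , refl))
  ... | there q = q
  rest⁻ : ∀ {z c k} → (z , c , k) ∈ rest → (z , c , k) ∈ E × ¬ (c ≡ y × z ≡ suc x)
  rest⁻ p = Perm.∈-resp-↭ (↭-sym E↭) (there p) , λ { (refl , refl) →
    All.lookup (AllPairs.head (proj₂ (WellFormed-resp-↭ E↭ wf))) (∈-map⁺ pos p) refl }
  result : ∀ g → OneDown g E x y
  result false = record
    { step = kohnert E↭ right x≥1 ≤-refl empty run
    ; wf' = proj₁ (kohnert⇒Move wf E↭ right x≥1 ≤-refl empty run)
    ; landed = here refl
    ; tallied = sym (ghosts-↭ E↭)
    ; kept = λ p ≢ → there (in-rest p ≢)
    ; cells⁻ = λ { (here refl) → inj₁ (refl , refl) ; (there p) → inj₂ (inj₂ (rest⁻ p)) } }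
  result true = record
    { step = ghostMove E↭ right x≥1 ≤-refl empty run
    ; wf' = proj₁ (ghostMove⇒Move wf E↭ right x≥1 ≤-refl empty run)
    ; landed = here refl
    ; tallied = cong suc (sym (ghosts-↭ E↭))
    ; kept = λ p ≢ → there (there (in-rest p ≢))
    ; cells⁻ = λ { (here refl) → inj₁ (refl , refl) ; (there (here refl)) → inj₂ (inj₁ (_ , refl , refl))
                 ; (there (there p)) → inj₂ (inj₂ (rest⁻ p)) } }

-- `n` is the number of unit moves, from row `n + b` down to row `b`. `cleared` is confined to
-- Kohnert moves, as ghost moves leave a ghost in each row they vacate.
record Dropped (g : Bool) (n : ℕ) (E : Diagram) (b y : ℕ) : Set where
  field
    {E'} : Diagram
    path : InKKD E E'
    wf' : WellFormed E'
    tallied : ghosts E' ≡ tally g n + ghosts E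
    kept : ∀ {z c k} → (z , c , k) ∈ E → ¬ (c ≡ y × z ≤ n + b) → (z , c , k) ∈ E'
    cells⁻ : ∀ {z c k} → (z , c , k) ∈ E' → (z , c , k) ∈ E ⊎ (c ≡ y × z ≤ n + b)
    cleared : ¬ T g → ∀ {z k} → (z , y , k) ∈ E' → z ≤ n + b → z ≤ b

tally-suc : ∀ g n m → tally g n + (tally g 1 + m) ≡ tally g (suc n) + m
tally-suc true n m = +-suc n m
tally-suc false n m = refl

-- The last two hypotheses make the falling cell rightmost in each row it leaves and keep its column
-- free below it. Ghosts left behind lie above it and never obstruct the next move.
drop-cell : ∀ g n {E b y} → 1 ≤ b → WellFormed E → Ord E (n + b) y →
            (∀ {z c k} → (z , c , k) ∈ E → b < z → z ≤ n + b → c ≤ y) →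
            (∀ {z k} → (z , y , k) ∈ E → b ≤ z → ¬ z < n + b) → Dropped g n E b y
drop-cell g zero b≥1 wf o right empty = record
  { path = ε ; wf' = wf ; tallied = tally-zero g ; kept = λ p _ → p ; cells⁻ = inj₁ ; cleared = λ _ _ z≤ → z≤ }
  where
  tally-zero : ∀ g {m} → m ≡ tally g 0 + m
  tally-zero true = refl
  tally-zero false = refl
drop-cell g (suc n) {E} {b} {y} b≥1 wf o right empty = record
  { path = One.step ◅ Rest.path
  ; wf' = Rest.wf'
  ; tallied = trans Rest.tallied (trans (cong (tally g n +_) One.tallied) (tally-suc g n _))
  ; kept = λ p ≢ → Rest.kept (One.kept p λ { (refl , refl) → ≢ (refl , ≤-refl) })
                             λ { (refl , z≤) → ≢ (refl , m≤n⇒m≤1+n z≤) }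
  ; cells⁻ = cells⁻'
  ; cleared = cleared' }
  where
  one : OneDown g E (n + b) y
  one = one-down g wf o (≤-trans b≥1 (m≤n+m b n)) (λ p → right p (s≤s (m≤n+m b n)) ≤-refl)
          (λ k p → empty p (m≤n+m b n) ≤-refl)
  module One = OneDown one

  right' : ∀ {z c k} → (z , c , k) ∈ One.E' → b < z → z ≤ n + b → c ≤ y
  right' p b<z z≤ with One.cells⁻ p
  ... | inj₁ (refl , _) = ≤-refl
  ... | inj₂ (inj₁ (_ , refl , _)) = ≤-refl
  ... | inj₂ (inj₂ (q , _)) = right q b<z (m≤n⇒m≤1+n z≤)

  empty' : ∀ {z k} → (z , y , k) ∈ One.E' → b ≤ z → ¬ z < n + b
  empty' p b≤z z< with One.cells⁻ p
  ... | inj₁ (_ , refl) = <-irrefl refl z<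
  ... | inj₂ (inj₁ (_ , _ , refl)) = <-asym z< (n<1+n _)
  ... | inj₂ (inj₂ (q , _)) = empty q b≤z (m≤n⇒m≤1+n z<)

  module Rest = Dropped (drop-cell g n b≥1 One.wf' One.landed right' empty')

  cells⁻' : ∀ {z c k} → (z , c , k) ∈ Rest.E' → (z , c , k) ∈ E ⊎ (c ≡ y × z ≤ suc n + b)
  cells⁻' p with Rest.cells⁻ p
  ... | inj₂ (e , z≤) = inj₂ (e , m≤n⇒m≤1+n z≤)
  ... | inj₁ q with One.cells⁻ q
  ...   | inj₁ (e , refl) = inj₂ (e , n≤1+n _)
  ...   | inj₂ (inj₁ (_ , e , refl)) = inj₂ (e , ≤-refl)
  ...   | inj₂ (inj₂ (q' , _)) = inj₁ q'

  cleared' : ¬ T g → ∀ {z k} → (z , y , k) ∈ Rest.E' → z ≤ suc n + b → z ≤ b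
  cleared' ¬g p z≤ with m≤n⇒m<n∨m≡n z≤
  ... | inj₁ (s≤s z≤') = Rest.cleared ¬g p z≤'
  ... | inj₂ refl with Rest.cells⁻ p
  ...   | inj₂ (_ , z≤') = ⊥-elim (<-irrefl refl z≤')
  ...   | inj₁ q with One.cells⁻ q
  ...     | inj₁ (_ , e) = ⊥-elim (1+n≢n e)
  ...     | inj₂ (inj₁ (t , _)) = ⊥-elim (¬g t)
  ...     | inj₂ (inj₂ (_ , ≢)) = ⊥-elim (≢ (refl , refl))

-- Lower bound: packing the rows from bottom to top

module LowerBound (D : Diagram) (wfD : WellFormed D) (skew : GeneralizedSkew D) where
  open GeneralizedSkew skew using (noGhost)
  open Skew D wfD skew

  -- The columns with N D c r ≡ 0 are included since they, too, must not hold cells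
  -- to the right of the cells that are moved next.
  record Packed (r : ℕ) (M : List ℕ) (G : ℕ) (E : Diagram) : Set where
    field
      path : InKKD D E
      wf : WellFormed E
      above⁺ : ∀ {z c} → r < z → Ord D z c → Ord E z c
      above⁻ : ∀ {z c k} → r < z → (z , c , k) ∈ E → Ord D z c
      packed : ∀ {z c k} → c ∈ M ⊎ N D c r ≡ 0 → z ≤ r → (z , c , k) ∈ E → z ≤ N D c r
      ghost-count : ghosts E ≡ G

  -- Closure to the right guarantees that every nonempty column to the right of a falling cell has
  -- already been packed.
  Closed : ℕ → List ℕ → Set
  Closed r M = ∀ {c c' j} → c ∈ M → c < c' → j ≤ r → Ord D j c' → c' ∈ M

  N≡0⇒¬Ord : ∀ {c x} → 1 ≤ x → N D c x ≡ 0 → ¬ Ord D x c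
  N≡0⇒¬Ord 1≤x e o with () ← subst (1 ≤_) e (N-pos 1≤x o)

  N-suc≡0 : ∀ {c} x → N D c (suc x) ≡ 0 → N D c x ≡ 0
  N-suc≡0 {c} x e = n≤0⇒n≡0 (≤-trans (N-mono D c (n≤1+n x)) (≤-reflexive e))

  -- In use, `M'` is `M` together with the column of the dark cloud of row `d`, if there is one.
  -- Columns of `M'` are packed up to row `r`; those of `M` are to be packed up to row `d`.
  module Row (r : ℕ) (M M' : List ℕ) (M⊆M' : ∀ {c} → c ∈ M → c ∈ M') (G : ℕ) where
    d : ℕ
    d = suc r

    -- Row d is treated from right to left; the columns greater than y are done.
    record Swept (y : ℕ) (E : Diagram) : Set where
      field
        path : InKKD D E
        wf : WellFormed E
        same⁺ : ∀ {z c} → d < z ⊎ (z ≡ d × c ≤ y) → Ord D z c → Ord E z c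
        same⁻ : ∀ {z c k} → d < z ⊎ (z ≡ d × c ≤ y) → (z , c , k) ∈ E → Ord D z c
        left : ∀ {z c k} → c ≤ y → c ∈ M' ⊎ N D c r ≡ 0 → z ≤ r → (z , c , k) ∈ E → z ≤ N D c r
        right : ∀ {z c k} → y < c → c ∈ M ⊎ N D c d ≡ 0 → z ≤ d → (z , c , k) ∈ E → z ≤ N D c d
        ghost-count : ghosts E ≡ G

    weaken : ∀ {c} → c ∈ M ⊎ N D c d ≡ 0 → c ∈ M' ⊎ N D c r ≡ 0
    weaken = [ inj₁ ∘ M⊆M' , inj₂ ∘ N-suc≡0 r ]′

    sweep-start : ∀ {E} C → (∀ {r c} → Ord D r c → c ≤ C) → Packed r M' G E → Swept C E
    sweep-start {E} C ≤C p = record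
      { path = path ; wf = wf
      ; same⁺ = λ { (inj₁ d<z) → above⁺ (<-trans (n<1+n r) d<z) ; (inj₂ (refl , _)) → above⁺ ≤-refl }
      ; same⁻ = λ { (inj₁ d<z) → above⁻ (<-trans (n<1+n r) d<z) ; (inj₂ (refl , _)) → above⁻ ≤-refl }
      ; left = λ _ → packed
      ; right = right
      ; ghost-count = ghost-count }
      where
      open Packed p
      right : ∀ {z c k} → C < c → c ∈ M ⊎ N D c d ≡ 0 → z ≤ d → (z , c , k) ∈ E → z ≤ N D c d
      right {c = c} C<c m z≤d q with m≤n⇒m<n∨m≡n z≤d
      ... | inj₂ refl = ⊥-elim (<⇒≱ C<c (≤C (above⁻ ≤-refl q)))
      ... | inj₁ (s≤s z≤r) = ≤-trans (packed (weaken m) z≤r q) (N-mono D c (n≤1+n r))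

    -- The target row is b = N D y d. By `left`, column `y` is filled at most up to `N D y r`, which
    -- is b - 1, so the way down is free. By `N-nested`, the columns to the right are filled at most
    -- up to `b`, so the cell is rightmost in every row above `b`.
    drop-column : ∀ g {y E} → Swept y E → Ord D d y → y ∈ M' →
                  (∀ {c j} → y < c → j ≤ d → Ord D j c → c ∈ M) →
                  ∃[ n ] (n + N D y d ≡ d × Dropped g n E (N D y d) y)
    drop-column g {y} {E} s o y∈M' right∈M =
      n , n+b≡d , drop-cell g n b≥1 wf
        (subst (λ z → Ord E z y) (sym n+b≡d) (same⁺ (inj₂ (refl , ≤-refl)) o))
        (λ q b<z z≤ → ≮⇒≥ λ y<c → <⇒≱ b<z
           (≤-trans (right y<c (in-M y<c) (≤-trans z≤ (≤-reflexive n+b≡d)) q)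
                    (N-nested d ≤-refl (<⇒≤ y<c) o)))
        (λ q b≤z z< → <⇒≱ (≤-trans (≤-reflexive (sym (N-suc-in o))) b≤z)
           (left ≤-refl (inj₁ y∈M') (≤-pred (≤-trans z< (≤-reflexive n+b≡d))) q))
      where
      open Swept s
      b = N D y d
      n = d ∸ b
      n+b≡d : n + b ≡ d
      n+b≡d = m∸n+n≡m (N≤ D y d)
      b≥1 : 1 ≤ b
      b≥1 = N-pos (s≤s z≤n) o
      in-M : ∀ {c} → y < c → c ∈ M ⊎ N D c d ≡ 0
      in-M {c} y<c with N D c d in eq
      ... | zero = inj₂ refl
      ... | suc _ with j , j≤d , oj ← N-pos⁻ {D} {c} d (subst (1 ≤_) (sym eq) (s≤s z≤n)) =
        inj₁ (right∈M y<c j≤d oj)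

    sweep-column : ∀ {y E} → Closed d M → Swept (suc y) E → (Ord D d (suc y) → suc y ∈ M) → ∃[ E' ] Swept y E'
    sweep-column {y} {E} closed s ∈M with (d , suc y , ordinary) ∈? D
    ... | no ¬o = E , record
      { path = path ; wf = wf
      ; same⁺ = λ m → same⁺ (relax m) ; same⁻ = λ m → same⁻ (relax m)
      ; left = λ c≤y → left (m≤n⇒m≤1+n c≤y)
      ; right = right'
      ; ghost-count = ghost-count }
      where
      open Swept s
      relax : ∀ {z c} → d < z ⊎ (z ≡ d × c ≤ y) → d < z ⊎ (z ≡ d × c ≤ suc y)
      relax = [ inj₁ , (λ { (e , c≤y) → inj₂ (e , m≤n⇒m≤1+n c≤y) }) ]′
      right' : ∀ {z c k} → y < c → c ∈ M ⊎ N D c d ≡ 0 → z ≤ d → (z , c , k) ∈ E → z ≤ N D c d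
      right' y<c m z≤d q with m≤n⇒m<n∨m≡n y<c
      ... | inj₁ y+1<c = right y+1<c m z≤d q
      ... | inj₂ refl with m≤n⇒m<n∨m≡n z≤d
      -- Row `d` is still that of `D` in this column, hence empty there.
      ...   | inj₂ refl = ⊥-elim (¬o (same⁻ (inj₂ (refl , ≤-refl)) q))
      ...   | inj₁ (s≤s z≤r) = ≤-trans (left ≤-refl (weaken m) z≤r q) (N-mono D (suc y) (n≤1+n r))
    ... | yes o with n , n+b≡d , dropped ← drop-column false s o (M⊆M' (∈M o)) (closed (∈M o)) =
      Drop.E' , record
      { path = path ◅◅ Drop.path ; wf = Drop.wf'
      ; same⁺ = λ { (inj₁ d<z) p → Drop.kept (same⁺ (inj₁ d<z) p) (λ { (_ , z≤) → <⇒≱ d<z (≤d z≤) })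
                  ; (inj₂ (e , c≤y)) p → Drop.kept (same⁺ (inj₂ (e , m≤n⇒m≤1+n c≤y)) p) (λ { (refl , _) → <-irrefl refl c≤y }) }
      ; same⁻ = same⁻'
      ; left = left'
      ; right = right'
      ; ghost-count = trans Drop.tallied ghost-count }
      where
      open Swept s
      module Drop = Dropped dropped
      ≤d : ∀ {z} → z ≤ n + N D (suc y) d → z ≤ d
      ≤d z≤ = ≤-trans z≤ (≤-reflexive n+b≡d)
      same⁻' : ∀ {z c k} → d < z ⊎ (z ≡ d × c ≤ y) → (z , c , k) ∈ Drop.E' → Ord D z c
      same⁻' m q with Drop.cells⁻ q
      same⁻' (inj₁ d<z) q | inj₁ p = same⁻ (inj₁ d<z) p
      same⁻' (inj₂ (e , c≤y)) q | inj₁ p = same⁻ (inj₂ (e , m≤n⇒m≤1+n c≤y)) p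
      same⁻' (inj₁ d<z) q | inj₂ (_ , z≤) = ⊥-elim (<⇒≱ d<z (≤d z≤))
      same⁻' (inj₂ (_ , c≤y)) q | inj₂ (refl , _) = ⊥-elim (<-irrefl refl c≤y)
      left' : ∀ {z c k} → c ≤ y → c ∈ M' ⊎ N D c r ≡ 0 → z ≤ r → (z , c , k) ∈ Drop.E' → z ≤ N D c r
      left' c≤y m z≤r q with Drop.cells⁻ q
      ... | inj₁ p = left (m≤n⇒m≤1+n c≤y) m z≤r p
      ... | inj₂ (refl , _) = ⊥-elim (<-irrefl refl c≤y)
      right' : ∀ {z c k} → y < c → c ∈ M ⊎ N D c d ≡ 0 → z ≤ d → (z , c , k) ∈ Drop.E' → z ≤ N D c d
      right' y<c m z≤d q with m≤n⇒m<n∨m≡n y<c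
      -- The moves were Kohnert moves, so nothing remains above the target row.
      ... | inj₂ refl = Drop.cleared (λ ()) q (≤-trans z≤d (≤-reflexive (sym n+b≡d)))
      ... | inj₁ y+1<c with Drop.cells⁻ q
      ...   | inj₁ p = right y+1<c m z≤d p
      ...   | inj₂ (refl , _) = ⊥-elim (<-irrefl refl y+1<c)

    sweep : ∀ n {y E} → Closed d M → (∀ {c} → y < c → Ord D d c → c ∈ M) → Swept (n + y) E → ∃[ E' ] Swept y E'
    sweep zero closed ∈M s = _ , s
    sweep (suc n) {y} closed ∈M s with E' , s' ← sweep-column closed s (∈M (s≤s (m≤n+m y n))) =
      sweep n closed ∈M s'

  noGhost⇒ghosts≡0 : ghosts D ≡ 0
  noGhost⇒ghosts≡0 = cong length (filter-none (T? ∘ isGhost) (All.tabulate λ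
    { {_ , _ , ordinary} _ () ; {r , c , ghost} m _ → noGhost r c m }))

  -- Clouds are marked from top to bottom, but rows are treated from bottom to top: the mark of row
  -- `suc r` is passed down in `M`, and the row is treated after the recursive call has dealt with
  -- the rows below it.
  greedy : ∀ r M → Closed r M → ∃[ E ] Packed r M (snow r M) E
  greedy zero M closed = D , record
    { path = ε ; wf = wfD ; above⁺ = λ _ o → o ; above⁻ = λ _ → cell⇒ord
    ; packed = λ { _ z≤n m → z≤n } ; ghost-count = noGhost⇒ghosts≡0 }
  greedy (suc r) M closed with maxMaybe (candidates D (suc r) M) in eq
  ... | nothing = cloudless
    where
    marked : ∀ {c} → 0 < c → Ord D (suc r) c → c ∈ M
    marked {c} _ o with c ∈ℕ? M
    ... | yes m = m
    ... | no c∉M with () ← subst (c ∈_) (maxMaybe-nothing _ eq) (∈-candidates⁺ D (suc r) M o c∉M)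

    cloudless : ∃[ E ] Packed (suc r) M (snow r M) E
    cloudless with E , p ← greedy r M (λ m c<c' j≤r → closed m c<c' (m≤n⇒m≤1+n j≤r)) = finish
      where
      open Row r M M (λ m → m) (snow r M)
      finish : ∃[ E ] Packed (suc r) M (snow r M) E
      finish with E' , s ← sweep column-bound closed marked
                    (subst (λ y → Swept y E) (sym (+-identityʳ column-bound))
                      (sweep-start column-bound ≤column-bound p)) =
        E' , record
        { path = path ; wf = wf ; above⁺ = λ d<z → same⁺ (inj₁ d<z) ; above⁻ = λ d<z → same⁻ (inj₁ d<z)
        -- Columns start at 1, so a sweep that ends with y = 0 has covered them all.
        ; packed = λ m z≤d q → right (col≥1 wf q) m z≤d q
        ; ghost-count = ghost-count }
        where open Swept s
  ... | just m = cloud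
    where
    d = suc r
    m-cand = proj₁ (maxMaybe-just _ eq)
    m∉M = proj₂ (∈-candidates⁻ D (suc r) M m-cand)
    om : Ord D d m
    om = cell⇒ord (proj₂ (proj₁ (∈-candidates⁻ D (suc r) M m-cand)))
    marked : ∀ {c} → m < c → Ord D d c → c ∈ M
    marked {c} m<c o with c ∈ℕ? M
    ... | yes c∈M = c∈M
    ... | no c∉M = ⊥-elim (<⇒≱ m<c (proj₂ (maxMaybe-just _ eq) (∈-candidates⁺ D d M o c∉M)))
    -- By `between`, a column right of `m` with a cell in row `j` also has one in row `d`, and there
    -- the cells right of the dark cloud are in marked columns.
    marked-below : ∀ {c j} → m < c → j ≤ d → Ord D j c → c ∈ M
    marked-below m<c j≤d o = marked m<c (between j≤d ≤-refl o om om (<⇒≤ m<c) ≤-refl)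
    closed' : Closed r (m ∷ M)
    closed' (here refl) c<c' j≤r o = there (marked-below c<c' (m≤n⇒m≤1+n j≤r) o)
    closed' (there c∈M) c<c' j≤r o = there (closed c∈M c<c' (m≤n⇒m≤1+n j≤r) o)

    cloud : ∃[ E ] Packed d M (snowBelow D (d , m) + snow r (m ∷ M)) E
    cloud with E , p ← greedy r (m ∷ M) closed' = finish
      where
      open Row r M (m ∷ M) there (snow r (m ∷ M)) hiding (d)
      finish : ∃[ E ] Packed d M (snowBelow D (d , m) + snow r (m ∷ M)) E
      -- The sweep by Kohnert moves stops at y = m; the dark cloud is then dropped by ghost moves.
      finish with E' , s ← sweep (column-bound ∸ m) closed marked
                    (subst (λ y → Swept y E) (sym (m∸n+n≡m (≤column-bound om)))
                      (sweep-start column-bound ≤column-bound p))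
             with n , n+b≡d , dropped ← drop-column true s om (here refl) marked-below =
        Drop.E' , record
        { path = path ◅◅ Drop.path ; wf = Drop.wf'
        ; above⁺ = λ d<z o → Drop.kept (same⁺ (inj₁ d<z) o) (λ { (_ , z≤) → <⇒≱ d<z (≤d z≤) })
        ; above⁻ = above⁻' ; packed = packed'
        ; ghost-count = trans Drop.tallied (cong₂ _+_ n≡snow ghost-count) }
        where
        open Swept s
        module Drop = Dropped dropped
        ≤d : ∀ {z} → z ≤ n + N D m d → z ≤ d
        ≤d z≤ = ≤-trans z≤ (≤-reflexive n+b≡d)
        n≡snow : n ≡ snowBelow D (d , m)
        n≡snow = +-cancelʳ-≡ (N D m d) n _ (trans n+b≡d (sym (snow+N≡row om)))
        above⁻' : ∀ {z c k} → d < z → (z , c , k) ∈ Drop.E' → Ord D z c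
        above⁻' d<z q with Drop.cells⁻ q
        ... | inj₁ q' = same⁻ (inj₁ d<z) q'
        ... | inj₂ (_ , z≤) = ⊥-elim (<⇒≱ d<z (≤d z≤))
        -- Column `m`, where the ghosts are left, is exempt from packing: it is not in `M` and has a
        -- cell in row `d`.
        not-m : ∀ {c} → c ∈ M ⊎ N D c d ≡ 0 → c ≢ m
        not-m (inj₁ c∈M) refl = m∉M c∈M
        not-m (inj₂ e) refl = N≡0⇒¬Ord (s≤s z≤n) e om
        packed' : ∀ {z c k} → c ∈ M ⊎ N D c d ≡ 0 → z ≤ d → (z , c , k) ∈ Drop.E' → z ≤ N D c d
        packed' {z} {c} h z≤d q with Drop.cells⁻ q
        ... | inj₂ (refl , _) = ⊥-elim (not-m h refl)
        ... | inj₁ q' with <-cmp c m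
        ...   | tri≈ _ e _ = ⊥-elim (not-m h e)
        ...   | tri> _ _ m<c = right m<c h z≤d q'
        ...   | tri< c<m _ _ with h | m≤n⇒m<n∨m≡n z≤d
        ...     | inj₁ c∈M | _ = ⊥-elim (m∉M (closed c∈M c<m ≤-refl om))
        ...     | inj₂ e | inj₂ refl =
          ⊥-elim (N≡0⇒¬Ord (s≤s z≤n) e (same⁻ (inj₂ (refl , <⇒≤ c<m)) q'))
        ...     | inj₂ e | inj₁ (s≤s z≤r) =
          ≤-trans (left (<⇒≤ c<m) (inj₂ (N-suc≡0 r e)) z≤r q') (N-mono D c (n≤1+n r))

-- The two bounds combined

theorem3p7 : (D : Diagram) → WellFormed D → GeneralizedSkew D → IsMaxG D (sf D)
theorem3p7 D wf skew with E , p ← LowerBound.greedy D wf skew (maxRow D) [] (λ ()) =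
  (E , Packed.path p , Packed.ghost-count p) , λ _ → UpperBound.ghosts≤sf D wf skew
  where open LowerBound D wf skew using (module Packed)
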